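{- It is decidable in polynomial time whether a given guessing history $\mathcal{H}=(x^i,s^i)_{i=1}^t$ (with $x^i\in\{0,1\}^n$, $s^i\in[0..n]$) is feasible. Furthermore, the number of pairs $(z,\pi)\in\{0,1\}^n\times S_n$ consistent with $\mathcal{H}$ can be computed efficiently (in polynomial time).
   Context: $[n]=\{1,\dots,n\}$, $[0..n]=\{0,1,\dots,n\}$, and $S_n$ is the set of permutations of $[n]$. For $z\in\{0,1\}^n$ and $\pi\in S_n$ define $f_{z,\pi}:\{0,1\}^n\to[0..n]$ by $f_{z,\pi}(x)=\max\{i\in[0..n]\mid \forall j\le i:\ z_{\pi(j)}=x_{\pi(j)}\}$. A guessing history is a finite sequence $\mathcal{H}=(x^i,s^i)_{i=1}^t$ of queries $x^i\in\{0,1\}^n$ and scores $s^i\in[0..n]$. A secret $(z,\pi)\in\{0,1\}^n\times S_n$ is consistent with $\mathcal{H}$ if $f_{z,\pi}(x^i)=s^i$ for all $i\in[t]$. $\mathcal{H}$ is feasible if there exists a secret consistent with it. Polynomial time means polynomial in the size of the input history, i.e. in $n$ and $t$. -}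

module Defs where

open import Data.Bool using (Bool; true; false)
import Data.Bool.Properties as Bool
open import Data.Fin using (Fin; zero; suc; toℕ)
open import Data.Fin.Permutation using (Permutation′; _⟨$⟩ʳ_)
import Data.Fin.Properties as Fin
open import Data.List using (allFin; filter)
import Data.List.Extrema as Extrema
open import Data.Nat using (ℕ; zero; suc; _+_; _*_; _^_; _<_; _≤_; _≟_)
import Data.Nat.Binary as Bin
import Data.Nat.Properties as ℕ
open import Data.Product using (∃-syntax; _×_; _,_; proj₁)
open import Data.Product.Relation.Binary.Pointwise.NonDependent using (×-setoid)
open import Data.Vec using (Vec; []; _∷_; lookup)
open import Function.Bundles using (Inverse)
open import Level using (0ℓ)
open import Relation.Binary using (Setoid)
import Relation.Binary.Construct.On as On
open import Relation.Binary.PropositionalEquality using (_≡_; setoid; _→-setoid_)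
open import Relation.Nullary using (Dec; yes; no; Reflects)
open import Relation.Nullary.Decidable using (_→-dec_)

------------------------------------------------------------------------
-- The guessing game
--
-- Positions [n] are 0-based: j : Fin n stands for position toℕ j + 1, so
-- "j ≤ i" becomes toℕ j < toℕ i.  Scores [0..n] are Fin (suc n).

Secret : ℕ → Set
Secret n = Vec Bool n × Permutation′ n

AgreesUpTo : ∀ {n} → Secret n → Vec Bool n → Fin (suc n) → Set
AgreesUpTo {n} (z , π) x i =
  (j : Fin n) → toℕ j < toℕ i → lookup z (π ⟨$⟩ʳ j) ≡ lookup x (π ⟨$⟩ʳ j)

agreesUpTo? : ∀ {n} (s : Secret n) x i → Dec (AgreesUpTo s x i)
agreesUpTo? (z , π) x i = Fin.all? λ j →
  (toℕ j ℕ.<? toℕ i) →-dec (lookup z (π ⟨$⟩ʳ j) Bool.≟ lookup x (π ⟨$⟩ʳ j))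

-- The default value zero of the library's max is harmless: i = 0 always
-- belongs to the set.
f : ∀ {n} → Secret n → Vec Bool n → Fin (suc n)
f {n} s x = max zero (filter (agreesUpTo? s x) (allFin (suc n)))
  where open Extrema (Fin.≤-totalOrder (suc n)) using (max)

History : ℕ → ℕ → Set
History n t = Vec (Vec Bool n × Fin (suc n)) t

Consistent : ∀ {n t} → Secret n → History n t → Set
Consistent {t = t} s H =
  (i : Fin t) → let (x , score) = lookup H i in f s x ≡ score

Feasible : ∀ {n t} → History n t → Set
Feasible {n} H = ∃[ s ] Consistent {n} s H

-- Permutations are compared as functions (by their values).
secretSetoid : ℕ → Setoid 0ℓ 0ℓ
secretSetoid n =
  ×-setoid (setoid (Vec Bool n)) (On.setoid (Fin n →-setoid Fin n) _⟨$⟩ʳ_)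

-- The subset of secrets consistent with H; the equality ignores the proof
-- of consistency.
consistentSecrets : ∀ {n t} → History n t → Setoid 0ℓ 0ℓ
consistentSecrets {n} H =
  On.setoid {B = ∃[ s ] Consistent {n} s H} (secretSetoid n) proj₁

HasCardinality : Setoid 0ℓ 0ℓ → ℕ → Set
HasCardinality S k = Inverse (setoid (Fin k)) S

------------------------------------------------------------------------
-- The machine model: Jones' imperative language WHILE over binary trees
-- (N. D. Jones, "Computability and Complexity: From a Programming
-- Perspective", MIT Press 1997).  With the cost measure below (one unit per
-- elementary operation on a tree, trees being pointers to immutable
-- cells), its polynomial-time decision problems are exactly those of
-- Turing machines.

infixr 5 _∙_

data Tree : Set where
  nil : Tree
  _∙_ : Tree → Tree → Tree

data Expr : Set where
  var  : ℕ → Expr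
  nil  : Expr
  cons : Expr → Expr → Expr
  hd   : Expr → Expr
  tl   : Expr → Expr

infix  6 _:=_
infixr 5 _⨾_

data Cmd : Set where
  _:=_          : ℕ → Expr → Cmd
  _⨾_           : Cmd → Cmd → Cmd
  if_then_else_ : Expr → Cmd → Cmd → Cmd
  while_loop_   : Expr → Cmd → Cmd

Store : Set
Store = ℕ → Tree

_[_↦_] : Store → ℕ → Tree → Store
(σ [ x ↦ d ]) y with x ≟ y
... | yes _ = d
... | no  _ = σ y

head tail : Tree → Tree
head nil     = nil
head (l ∙ _) = l
tail nil     = nil
tail (_ ∙ r) = r

⟦_⟧ : Expr → Store → Tree
⟦ var x ⟧    σ = σ x
⟦ nil ⟧      σ = nil
⟦ cons a b ⟧ σ = ⟦ a ⟧ σ ∙ ⟦ b ⟧ σ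
⟦ hd a ⟧     σ = head (⟦ a ⟧ σ)
⟦ tl a ⟧     σ = tail (⟦ a ⟧ σ)

cost : Expr → ℕ
cost (var _)    = 1
cost nil        = 1
cost (cons a b) = suc (cost a + cost b)
cost (hd a)     = suc (cost a)
cost (tl a)     = suc (cost a)

-- ⟨ c , σ ⟩⇓⟨ σ′ , T ⟩: run from σ, the command c halts in store σ′ after
-- exactly T time units.  A test succeeds when its value is not nil.
data ⟨_,_⟩⇓⟨_,_⟩ : Cmd → Store → Store → ℕ → Set where
  assign : ∀ {x e σ} →
    ⟨ x := e , σ ⟩⇓⟨ σ [ x ↦ ⟦ e ⟧ σ ] , suc (cost e) ⟩
  seq : ∀ {c d σ σ′ σ″ S T} →
    ⟨ c , σ ⟩⇓⟨ σ′ , S ⟩ → ⟨ d , σ′ ⟩⇓⟨ σ″ , T ⟩ →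
    ⟨ c ⨾ d , σ ⟩⇓⟨ σ″ , S + T ⟩
  if-true : ∀ {e c d σ σ′ l r T} →
    ⟦ e ⟧ σ ≡ l ∙ r → ⟨ c , σ ⟩⇓⟨ σ′ , T ⟩ →
    ⟨ if e then c else d , σ ⟩⇓⟨ σ′ , suc (cost e + T) ⟩
  if-false : ∀ {e c d σ σ′ T} →
    ⟦ e ⟧ σ ≡ nil → ⟨ d , σ ⟩⇓⟨ σ′ , T ⟩ →
    ⟨ if e then c else d , σ ⟩⇓⟨ σ′ , suc (cost e + T) ⟩
  while-true : ∀ {e c σ σ′ σ″ l r S T} →
    ⟦ e ⟧ σ ≡ l ∙ r → ⟨ c , σ ⟩⇓⟨ σ′ , S ⟩ →
    ⟨ while e loop c , σ′ ⟩⇓⟨ σ″ , T ⟩ →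
    ⟨ while e loop c , σ ⟩⇓⟨ σ″ , suc (cost e + (S + T)) ⟩
  while-false : ∀ {e c σ} →
    ⟦ e ⟧ σ ≡ nil →
    ⟨ while e loop c , σ ⟩⇓⟨ σ , suc (cost e) ⟩

-- Input and output are held in variable 0; all other variables start as nil.
_on_yields_within_ : Cmd → Tree → Tree → ℕ → Set
p on d yields e within B =
  ∃[ σ′ ] ∃[ T ] ⟨ p , (λ _ → nil) [ 0 ↦ d ] ⟩⇓⟨ σ′ , T ⟩ × σ′ 0 ≡ e × T ≤ B

------------------------------------------------------------------------
-- Data representation

encodeBool : Bool → Tree
encodeBool false = nil
encodeBool true  = nil ∙ nil

unary : ℕ → Tree
unary zero    = nil
unary (suc k) = nil ∙ unary k

-- The library's binary numerals: lists of digits in bijective base 2, least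
-- significant digit first, with digit 1 as nil and digit 2 as nil ∙ nil.
encodeBin : Bin.ℕᵇ → Tree
encodeBin Bin.zero     = nil
encodeBin Bin.1+[2 b ] = nil ∙ encodeBin b
encodeBin Bin.2[1+ b ] = (nil ∙ nil) ∙ encodeBin b

binary : ℕ → Tree
binary k = encodeBin (Bin.fromℕ k)

encodeVec : ∀ {A : Set} {k} → (A → Tree) → Vec A k → Tree
encodeVec enc []       = nil
encodeVec enc (a ∷ as) = enc a ∙ encodeVec enc as

-- n is listed explicitly, since it cannot be recovered from an empty
-- history.  It and the scores may be in unary because running times are
-- measured in n and t themselves; the size of this tree is O(n t + n + t).
encodeHistory : ∀ {n t} → History n t → Tree
encodeHistory {n} H =
  unary n ∙ encodeVec (λ (x , s) → encodeVec encodeBool x ∙ unary (toℕ s)) H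

------------------------------------------------------------------------
-- Polynomial time
--
-- A bound c (1 + n + t)^d is the general form of a polynomial bound in n
-- and t.  A single program has to serve all n and t.

DecidableInPolynomialTime : (∀ {n t} → History n t → Set) → Set
DecidableInPolynomialTime P =
  ∃[ p ] ∃[ c ] ∃[ d ] ∀ {n t} (H : History n t) →
    ∃[ b ] Reflects (P H) b ×
      p on encodeHistory H yields encodeBool b within (c * suc (n + t) ^ d)

-- R H k says that k is the value at H of the function to be computed; the
-- value is output in binary.
ComputableInPolynomialTime : (∀ {n t} → History n t → ℕ → Set) → Set
ComputableInPolynomialTime R =
  ∃[ p ] ∃[ c ] ∃[ d ] ∀ {n t} (H : History n t) →
    ∃[ k ] R H k ×
      p on encodeHistory H yields binary k within (c * suc (n + t) ^ d)

{-# OPTIONS --safe #-}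
-- Let r = suc s ∸ j for a query x with score s.  A secret is consistent iff at each
-- position j the choice (p , b) = (π j , z_{π j}) satisfies, for every query,
-- x_p ≢ b if r = 1 and x_p ≡ b if r ≥ 2.  If (p , b) satisfies this at some i < j,
-- then x_p ≡ b for all queries with score at least j, so the number of bits allowed
-- for p at j is the same number w_j for all such p.  Hence, with M_j the total
-- number of choices allowed at j, every choice for the positions below j extends to
-- j in exactly M_j ∸ j * w_j ways, and the count is the product of these factors.
--
-- The product is computed by a language of loops over a fixed clock of length about
-- n + t: there, running times are polynomial by the syntax alone.

module Submission where

open import Defs
open import Data.Bool using (Bool; true; false; not; _∧_; _∨_; _xor_; T; T?)
open import Data.Bool.Properties using (T-∧; ∧-assoc; ∧-identityʳ; ∧-zeroʳ; ∨-zeroʳ)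
open import Data.Fin using (Fin; zero; suc; toℕ; fromℕ<; opposite; punchOut)
open import Data.Fin.Permutation
  using (Permutation′; _⟨$⟩ʳ_; _⟨$⟩ˡ_; permutation; inverseˡ; inverseʳ)
import Data.Fin.Properties as Fin
open import Data.List as List
  using (List; []; _∷_; length; map; concatMap; filter; allFin; cartesianProduct)
open import Data.List.Extrema using (argmax-all; xs≤max)
open import Data.List.Membership.Propositional using (_∈_; find; lose)
open import Data.List.Membership.Propositional.Properties
  using (∈-allFin; ∈-filter⁺; ∈-filter⁻; ∈-cartesianProduct⁺; ∈-concatMap⁺; ∈-concatMap⁻;
         ∈-map⁺; ∈-map⁻; ∈-lookup)
open import Data.List.Properties using (length-map; length-++)
open import Data.List.Relation.Binary.Disjoint.Propositional using (Disjoint)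
open import Data.List.Relation.Unary.All as All using (All; []; _∷_)
import Data.List.Relation.Unary.All.Properties as All
open import Data.List.Relation.Unary.AllPairs as AllPairs using ([]; _∷_)
import Data.List.Relation.Unary.AllPairs.Properties as AllPairs
open import Data.List.Relation.Unary.Any using (here; there; index)
open import Data.List.Relation.Unary.Any.Properties using (lookup-index)
open import Data.List.Relation.Unary.Unique.Propositional using (Unique)
import Data.List.Relation.Unary.Unique.Propositional.Properties as Unique
open import Data.Nat
  using (ℕ; zero; suc; _+_; _*_; _∸_; _^_; _≤_; _<_; z≤n; s≤s; z<s; s<s)
open import Data.Nat.Binary as Bin using (ℕᵇ; 1+[2_]; 2[1+_])
open import Data.Nat.Binary.Properties using (fromℕ-toℕ; toℕ-fromℕ)
open import Data.Nat.GeneralisedArithmetic using (iterate)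
open import Data.Nat.Properties
open import Algebra.Properties.CommutativeMonoid.Sum +-0-commutativeMonoid using (sum; sum-cong-≗)
open import Data.Nat.Tactic.RingSolver using (solve-∀)
open import Data.Product using (∃-syntax; _×_; _,_; proj₁; proj₂)
open import Data.Sum using (inj₁; inj₂)
open import Data.Unit using (⊤)
open import Data.Vec using (Vec; []; _∷_; lookup; tabulate)
open import Data.Vec.Properties using (lookup∘tabulate; tabulate∘lookup; tabulate-cong)
open import Function using (_∘_; id; _⇔_; mk⇔; Equivalence; Inverse; Injective)
open import Relation.Binary using (Setoid; tri<; tri≈; tri>)
open import Relation.Binary.PropositionalEquality
open import Relation.Nullary using (yes; no; does; ¬_; contradiction; Reflects; ofʸ; ofⁿ)
open import Relation.Nullary.Decidable using (dec-true; dec-false)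

-- A language of clocked loops and its compilation to WHILE

-- The time bound of such a program depends on the clock alone, never on its argument, so for that
-- bound the sizes of intermediate trees need no control. The price is that a loop cannot stop
-- early: its body has to fix the final state, and the number of rounds has to be shown sufficient.
-- The product can be exponential in n and is therefore kept in binary, whereas the factors are at
-- most 2 n and stay in unary, so that multiplying by one of them is repeated addition. Feasibility
-- is read off as a nonzero count.

infixl 4 _⟫_

data Fun : Set where
  arg nil : Fun
  cons    : Fun → Fun → Fun
  hd tl   : Fun → Fun
  cond    : Fun → Fun → Fun → Fun
  _⟫_     : Fun → Fun → Fun
  rep     : Fun → Fun

branch : Tree → Tree → Tree → Tree
branch nil     a b = b
branch (_ ∙ _) a b = a

run : Fun → ℕ → Tree → Tree
run arg          L x = x
run nil          L x = nil
run (cons f g)   L x = run f L x ∙ run g L x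
run (hd f)       L x = head (run f L x)
run (tl f)       L x = tail (run f L x)
run (cond f g h) L x = branch (run f L x) (run g L x) (run h L x)
run (f ⟫ g)      L x = run g L (run f L x)
run (rep f)      L x = iterate (run f L) x L

-- Variable 0 holds the argument and then the value, variable 1 a stack of
-- saved trees, and variable 2 the unchanging clock unary L.
compile : Fun → Cmd
compile arg          = 0 := var 0
compile nil          = 0 := nil
compile (cons f g)   =
  1 := cons (var 0) (var 1) ⨾ compile f ⨾
  1 := cons (var 0) (var 1) ⨾ 0 := hd (tl (var 1)) ⨾ compile g ⨾
  0 := cons (hd (var 1)) (var 0) ⨾ 1 := tl (tl (var 1))
compile (hd f)       = compile f ⨾ 0 := hd (var 0)
compile (tl f)       = compile f ⨾ 0 := tl (var 0)
compile (cond f g h) =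
  1 := cons (var 0) (var 1) ⨾ compile f ⨾
  if var 0 then (0 := hd (var 1) ⨾ 1 := tl (var 1) ⨾ compile g)
           else (0 := hd (var 1) ⨾ 1 := tl (var 1) ⨾ compile h)
compile (f ⟫ g)      = compile f ⨾ compile g
compile (rep f)      =
  1 := cons (var 2) (var 1) ⨾
  while hd (var 1) loop (1 := cons (tl (hd (var 1))) (tl (var 1)) ⨾ compile f) ⨾
  1 := tl (var 1)

-- A conditional is charged for both branches, so that only sums and multiples by `L` arise and
-- `time-polynomial` meets no maximum. The constants are the costs of the assignments and tests in
-- `compile`.
time : Fun → ℕ → ℕ
time arg          L = 2
time nil          L = 2
time (cons f g)   L = 4 + (time f L + (4 + (4 + (time g L + (5 + 4)))))
time (hd f)       L = time f L + 3
time (tl f)       L = time f L + 3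
time (cond f g h) L = 4 + (time f L + suc (1 + (3 + (3 + (time g L + time h L)))))
time (f ⟫ g)      L = time f L + time g L
time (rep f)      L = 4 + ((L * (10 + time f L) + 3) + 3)

-- Correctness and running time of compiled programs.

record Holds (L : ℕ) (σ : Store) (x S : Tree) : Set where
  constructor holds
  field
    value : σ 0 ≡ x
    stack : σ 1 ≡ S
    clock : σ 2 ≡ unary L

private variable
  L m n t : ℕ
  σ : Store
  x S : Tree

Runs : ℕ → Cmd → Store → Tree → Tree → ℕ → Set
Runs L c σ y S B = ∃[ σ′ ] ∃[ T ] ⟨ c , σ ⟩⇓⟨ σ′ , T ⟩ × Holds L σ′ y S × T ≤ B

_then_ : ∀ {c d y z S′ B C} → Runs L c σ y S′ B →
  (∀ {σ′} → Holds L σ′ y S′ → Runs L d σ′ z S C) → Runs L (c ⨾ d) σ z S (B + C)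
(_ , _ , r , h , T≤B) then k with k h
... | _ , _ , r′ , h′ , T′≤C = _ , _ , seq r r′ , h′ , +-mono-≤ T≤B T′≤C

infixr 5 _then_

set-value : ∀ {e y} → Holds L σ x S → ⟦ e ⟧ σ ≡ y → Runs L (0 := e) σ y S (suc (cost e))
set-value (holds _ s c) eq = _ , _ , assign , holds eq s c , ≤-refl

set-stack : ∀ {e S′} → Holds L σ x S → ⟦ e ⟧ σ ≡ S′ → Runs L (1 := e) σ x S′ (suc (cost e))
set-stack (holds v _ c) eq = _ , _ , assign , holds v eq c , ≤-refl

weaken : ∀ {c y B C} → B ≤ C → Runs L c σ y S B → Runs L c σ y S C
weaken B≤C (_ , _ , r , h , T≤B) = _ , _ , r , h , ≤-trans T≤B B≤C

-- Quantified over the stack `S`, which is handed back unchanged: what `cons`, `cond` and `rep` save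
-- thus survives the compiled subterms.
compile-correct : ∀ f → Holds L σ x S → Runs L (compile f) σ (run f L x) S (time f L)

-- The number `k` of remaining rounds, on top of the stack, is kept apart from `L`, because loops
-- inside `f` still read the full clock. Besides `f`, a round costs 3 for the test and 7 for the
-- countdown.
loop-correct : ∀ f k → Holds L σ x (unary k ∙ S) →
  Runs L (while hd (var 1) loop (1 := cons (tl (hd (var 1))) (tl (var 1)) ⨾ compile f)) σ
    (iterate (run f L) x k) (nil ∙ S) (k * (10 + time f L) + 3)
loop-correct f zero    h = _ , _ , while-false (cong head (Holds.stack h)) , h , ≤-refl
loop-correct {L = L} {S = S} f (suc k) h
  with set-stack h (cong (λ s → tail (head s) ∙ tail s) (Holds.stack h))
         then compile-correct {S = unary k ∙ S} f
... | _ , T , r , h′ , T≤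
  with loop-correct f k h′
... | _ , T′ , r′ , h″ , T′≤ =
  _ , _ , while-true (cong head (Holds.stack h)) r r′ , h″ ,
  ≤-trans (+-monoʳ-≤ 3 (+-mono-≤ T≤ T′≤))
    (≤-reflexive (sym (+-assoc (10 + time f L) (k * (10 + time f L)) 3)))

compile-correct arg h = set-value h (Holds.value h)
compile-correct nil h = set-value h refl
compile-correct (cons f g) h =
  set-stack h (cong₂ _∙_ (Holds.value h) (Holds.stack h)) then λ h →
  compile-correct f h then λ h →
  set-stack h (cong₂ _∙_ (Holds.value h) (Holds.stack h)) then λ h →
  set-value h (cong (λ s → head (tail s)) (Holds.stack h)) then λ h →
  compile-correct g h then λ h →
  set-value h (cong₂ _∙_ (cong head (Holds.stack h)) (Holds.value h)) then λ h →
  set-stack h (cong (λ s → tail (tail s)) (Holds.stack h))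
compile-correct (hd f) h = compile-correct f h then λ h → set-value h (cong head (Holds.value h))
compile-correct (tl f) h = compile-correct f h then λ h → set-value h (cong tail (Holds.value h))
compile-correct {L = L} {x = x} {S = S} (cond f g k) h =
  set-stack h (cong₂ _∙_ (Holds.value h) (Holds.stack h)) then λ h →
  compile-correct f h then choose (run f L x) refl
  where
  restore : ∀ k {σ y} → Holds L σ y (x ∙ S) →
    Runs L (0 := hd (var 1) ⨾ 1 := tl (var 1) ⨾ compile k) σ (run k L x) S (3 + (3 + time k L))
  restore k h = set-value h (cong head (Holds.stack h)) then λ h →
    set-stack h (cong tail (Holds.stack h)) then compile-correct k

  choose : ∀ y → run f L x ≡ y → ∀ {σ} → Holds L σ (run f L x) (x ∙ S) →
    Runs L _ σ (branch (run f L x) (run g L x) (run k L x)) S _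
  choose nil eq h rewrite eq with restore k h
  ... | _ , _ , r , h′ , T≤ = _ , _ , if-false (Holds.value h) r , h′ ,
    +-monoʳ-≤ 2 (≤-trans T≤ (+-monoʳ-≤ 6 (m≤n+m (time k L) (time g L))))
  choose (_ ∙ _) eq h rewrite eq with restore g h
  ... | _ , _ , r , h′ , T≤ = _ , _ , if-true (Holds.value h) r , h′ ,
    +-monoʳ-≤ 2 (≤-trans T≤ (+-monoʳ-≤ 6 (m≤m+n (time g L) (time k L))))
compile-correct (f ⟫ g) h = compile-correct f h then compile-correct g
compile-correct {L = L} (rep f) h =
  set-stack h (cong₂ _∙_ (Holds.clock h) (Holds.stack h)) then λ h →
  loop-correct f L h then λ h →
  set-stack h (cong tail (Holds.stack h))

-- Polynomial bounds.

^-distrib-* : ∀ d m n → (m * n) ^ d ≡ m ^ d * n ^ d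
^-distrib-* zero    m n = refl
^-distrib-* (suc d) m n = trans (cong (m * n *_) (^-distrib-* d m n))
  ([m*n]*[o*p]≡[m*o]*[n*p] m n (m ^ d) (n ^ d))

Polynomial : (ℕ → ℕ) → Set
Polynomial t = ∃[ c ] ∃[ d ] ∀ L → t L ≤ c * suc L ^ d

const-polynomial : ∀ k → Polynomial λ _ → k
const-polynomial k = k , 0 , λ L → ≤-reflexive (sym (*-identityʳ k))

+-polynomial : ∀ {s t} → Polynomial s → Polynomial t → Polynomial λ L → s L + t L
+-polynomial {s} {t} (a , d , p) (b , e , q) = a + b , d + e , λ L → begin
  s L + t L                                     ≤⟨ +-mono-≤ (p L) (q L) ⟩
  a * suc L ^ d + b * suc L ^ e                 ≤⟨ +-mono-≤
    (*-monoʳ-≤ a (^-monoʳ-≤ (suc L) (m≤m+n d e)))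
    (*-monoʳ-≤ b (^-monoʳ-≤ (suc L) (m≤n+m e d))) ⟩
  a * suc L ^ (d + e) + b * suc L ^ (d + e)     ≡⟨ *-distribʳ-+ (suc L ^ (d + e)) a b ⟨
  (a + b) * suc L ^ (d + e)                     ∎
  where open ≤-Reasoning

scale-polynomial : ∀ {t} → Polynomial t → Polynomial λ L → L * t L
scale-polynomial {t} (a , d , p) = a , suc d , λ L → begin
  L * t L                   ≤⟨ *-mono-≤ (n≤1+n L) (p L) ⟩
  suc L * (a * suc L ^ d)   ≡⟨ *-comm (suc L) (a * suc L ^ d) ⟩
  a * suc L ^ d * suc L     ≡⟨ *-assoc a (suc L ^ d) (suc L) ⟩
  a * (suc L ^ d * suc L)   ≡⟨ cong (a *_) (*-comm (suc L ^ d) (suc L)) ⟩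
  a * suc L ^ suc d         ∎
  where open ≤-Reasoning

time-polynomial : ∀ f → Polynomial (time f)
time-polynomial arg = const-polynomial 2
time-polynomial nil = const-polynomial 2
time-polynomial (cons f g) =
  +-polynomial (const-polynomial 4) (+-polynomial (time-polynomial f)
    (+-polynomial (const-polynomial 8) (+-polynomial (time-polynomial g) (const-polynomial 9))))
time-polynomial (hd f) = +-polynomial (time-polynomial f) (const-polynomial 3)
time-polynomial (tl f) = +-polynomial (time-polynomial f) (const-polynomial 3)
time-polynomial (cond f g h) =
  +-polynomial (const-polynomial 4) (+-polynomial (time-polynomial f)
    (+-polynomial (const-polynomial 8) (+-polynomial (time-polynomial g) (time-polynomial h))))
time-polynomial (f ⟫ g) = +-polynomial (time-polynomial f) (time-polynomial g)
time-polynomial (rep f) =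
  +-polynomial (const-polynomial 4) (+-polynomial (+-polynomial
    (scale-polynomial (+-polynomial (const-polynomial 10) (time-polynomial f)))
    (const-polynomial 3)) (const-polynomial 3))

-- At least n and t, the lengths of all lists in the input.
clockLength : ℕ → ℕ → ℕ
clockLength n t = t + suc (suc n)

-- Setting the clock from the input.

setClock : Cmd
setClock =
  -- The two extra units make the cube of the clock large enough in `bits-fit` for small `n` as
  -- well.
  2 := cons nil (cons nil (hd (var 0))) ⨾ 3 := tl (var 0) ⨾
  while var 3 loop (2 := cons nil (var 2) ⨾ 3 := tl (var 3))

-- `m` is the clock built so far. A round costs 9, for a test and two assignments; the 2 is the last
-- test.
lengthen-clock : ∀ {A : Set} {t} (enc : A → Tree) (xs : Vec A t) m {σ} →
  Holds m σ x S → σ 3 ≡ encodeVec enc xs →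
  Runs (t + m) (while var 3 loop (2 := cons nil (var 2) ⨾ 3 := tl (var 3))) σ x S (9 * t + 2)
lengthen-clock enc [] m h e = _ , _ , while-false e , h , ≤-refl
lengthen-clock {t = suc t} enc (a ∷ xs) m {σ} (holds v s c) e
  with lengthen-clock enc xs (suc m) {(σ [ 2 ↦ nil ∙ σ 2 ]) [ 3 ↦ tail (σ 3) ]}
         (holds v s (cong (nil ∙_) c)) (cong tail e)
... | _ , _ , r , holds v′ s′ c′ , T≤ =
  _ , _ , while-true e (seq assign assign) r ,
  holds v′ s′ (trans c′ (cong unary (+-suc t m))) ,
  ≤-trans (+-monoʳ-≤ 9 T≤) (≤-reflexive (cong (_+ 2) (sym (*-suc 9 t))))

setClock-correct : ∀ {n t} (H : History n t) →
  Runs (clockLength n t) setClock ((λ _ → nil) [ 0 ↦ encodeHistory H ])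
    (encodeHistory H) nil (7 + (3 + (9 * t + 2)))
setClock-correct {n} H
  with lengthen-clock _ H (suc (suc n)) (holds refl refl refl) refl
... | _ , _ , r , h , T≤ =
  _ , _ , seq assign (seq assign r) , h , +-monoʳ-≤ 10 T≤

clockLength-bound : ∀ n t → suc (clockLength n t) ≤ 3 * suc (n + t)
clockLength-bound n t = begin
  suc (t + suc (suc n))   ≡⟨ cong suc (+-comm t (suc (suc n))) ⟩
  3 + (n + t)             ≤⟨ +-monoʳ-≤ 3 (m≤n*m (n + t) 3) ⟩
  3 + 3 * (n + t)         ≡⟨ *-suc 3 (n + t) ⟨
  3 * suc (n + t)         ∎
  where open ≤-Reasoning

polynomial-in-size : ∀ {s} → Polynomial s →
  ∃[ c ] ∃[ d ] ∀ n t → s (clockLength n t) ≤ c * suc (n + t) ^ d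
polynomial-in-size {s} (c , d , bound) = c * 3 ^ d , d , λ n t → begin
  s (clockLength n t)                 ≤⟨ bound (clockLength n t) ⟩
  c * suc (clockLength n t) ^ d       ≤⟨ *-monoʳ-≤ c (^-monoˡ-≤ d (clockLength-bound n t)) ⟩
  c * (3 * suc (n + t)) ^ d           ≡⟨ cong (c *_) (^-distrib-* d 3 (suc (n + t))) ⟩
  c * (3 ^ d * suc (n + t) ^ d)       ≡⟨ *-assoc c (3 ^ d) _ ⟨
  c * 3 ^ d * suc (n + t) ^ d         ∎
  where open ≤-Reasoning

total-time : Fun → ℕ → ℕ
total-time f L = (12 + L * 9) + time f L

setClock-time : ∀ f n t →
  (7 + (3 + (9 * t + 2))) + time f (clockLength n t) ≤ total-time f (clockLength n t)
setClock-time f n t = +-monoˡ-≤ (time f (clockLength n t)) (begin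
  10 + (9 * t + 2)            ≡⟨ cong (10 +_) (+-comm (9 * t) 2) ⟩
  12 + 9 * t                  ≡⟨ cong (12 +_) (*-comm 9 t) ⟩
  12 + t * 9                  ≤⟨ +-monoʳ-≤ 12 (*-monoˡ-≤ 9 (m≤m+n t (suc (suc n)))) ⟩
  12 + clockLength n t * 9    ∎)
  where open ≤-Reasoning

total-time-polynomial : ∀ f → Polynomial (total-time f)
total-time-polynomial f = +-polynomial (+-polynomial (const-polynomial 12)
  (scale-polynomial (const-polynomial 9))) (time-polynomial f)

start-correct : ∀ f {n t} (H : History n t) →
  Runs (clockLength n t) (setClock ⨾ compile f) ((λ _ → nil) [ 0 ↦ encodeHistory H ])
    (run f (clockLength n t) (encodeHistory H)) nil (total-time f (clockLength n t))
start-correct f {n} {t} H =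
  weaken (setClock-time f n t) (setClock-correct H then compile-correct f)

run-in-polynomial-time : (f : Fun) → ∃[ p ] ∃[ c ] ∃[ d ] ∀ {n t} (H : History n t) →
  p on encodeHistory H yields run f (clockLength n t) (encodeHistory H)
    within (c * suc (n + t) ^ d)
run-in-polynomial-time f =
  let c , d , bound = polynomial-in-size (total-time-polynomial f)
  in (setClock ⨾ compile f) , c , d , λ {n} {t} H →
    let σ′ , T , r , h , T≤ = start-correct f H
    in σ′ , T , r , Holds.value h , ≤-trans T≤ (bound n t)

-- Counting consistent secrets

-- The pointwise form of `f s x ≡ i`. For the full score no `j` meets the second clause, as `toℕ j`
-- stays below `n`.
Matches : Secret n → Vec Bool n → Fin (suc n) → Set
Matches {n} (z , π) x i = (j : Fin n) →
  (toℕ j < toℕ i → lookup x (π ⟨$⟩ʳ j) ≡ lookup z (π ⟨$⟩ʳ j)) ×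
  (toℕ j ≡ toℕ i → lookup x (π ⟨$⟩ʳ j) ≢ lookup z (π ⟨$⟩ʳ j))

f-agrees : (s : Secret n) (x : Vec Bool n) → AgreesUpTo s x (f s x)
f-agrees {n} s x = argmax-all (Fin.≤-totalOrder (suc n)) id {P = AgreesUpTo s x}
  (λ _ ()) (All.all-filter (agreesUpTo? s x) (allFin (suc n)))

f-largest : (s : Secret n) (x : Vec Bool n) (i : Fin (suc n)) →
  AgreesUpTo s x i → toℕ i ≤ toℕ (f s x)
f-largest {n} s x i agrees =
  All.lookup (xs≤max (Fin.≤-totalOrder (suc n)) zero (filter (agreesUpTo? s x) (allFin (suc n))))
    (∈-filter⁺ (agreesUpTo? s x) (∈-allFin i) agrees)

agrees-one-more : (s@(z , π) : Secret n) (x : Vec Bool n) (i : Fin (suc n)) (j : Fin n) →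
  AgreesUpTo s x i → toℕ j ≡ toℕ i → lookup z (π ⟨$⟩ʳ j) ≡ lookup x (π ⟨$⟩ʳ j) →
  AgreesUpTo s x (suc j)
agrees-one-more s x i j agrees j≡i eq k (s≤s k≤j) with m≤n⇒m<n∨m≡n k≤j
... | inj₁ k<j = agrees k (subst (toℕ k <_) j≡i k<j)
... | inj₂ k≡j rewrite Fin.toℕ-injective k≡j = eq

f≡⇒Matches : (s : Secret n) (x : Vec Bool n) {i : Fin (suc n)} → f s x ≡ i → Matches s x i
f≡⇒Matches s x refl j =
  (λ j<i → sym (f-agrees s x j j<i)) ,
  (λ j≡i eq → <-irrefl j≡i
    (f-largest s x (suc j) (agrees-one-more s x (f s x) j (f-agrees s x) j≡i (sym eq))))

Matches⇒f≡ : (s : Secret n) (x : Vec Bool n) {i : Fin (suc n)} → Matches s x i → f s x ≡ i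
Matches⇒f≡ {n} s x {i} matches =
  Fin.toℕ-injective (≤-antisym (≮⇒≥ i≮f) (f-largest s x i λ j j<i → sym (proj₁ (matches j) j<i)))
  where
  i≮f : ¬ toℕ i < toℕ (f s x)
  -- If `i` were below the score, it would be a position where the entries agree, against the second
  -- clause of `Matches`.
  i≮f i<f = proj₂ (matches j) (Fin.toℕ-fromℕ< i<n)
    (sym (f-agrees s x j (subst (_< toℕ (f s x)) (sym (Fin.toℕ-fromℕ< i<n)) i<f)))
    where
    i<n = <-≤-trans i<f (Fin.toℕ≤pred[n] (f s x))
    j = fromℕ< i<n

-- The constraint on the bit b = z_p of the column p placed at position j by a
-- query with score s and entry β = x_p depends only on suc s ∸ j: this is 0 if
-- s < j, 1 if s ≡ j, and at least 2 if j < s.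
permits : ℕ → Bool → Bool → Bool
permits zero          β b = true
permits (suc zero)    β b = β xor b
permits (suc (suc _)) β b = not (β xor b)

score>position : ∀ {j s} → j < s → ∃[ k ] suc s ∸ j ≡ suc (suc k)
score>position {zero}  {suc s} z<s       = s , refl
score>position {suc j} {suc s} (s<s j<s) = score>position j<s

score≡position : ∀ j → suc j ∸ j ≡ 1
score≡position = m+n∸n≡m 1

T-≡ : ∀ {β b} → T (not (β xor b)) → β ≡ b
T-≡ {false} {false} _ = refl
T-≡ {true}  {true}  _ = refl

≡-T : ∀ {β b} → β ≡ b → T (not (β xor b))
≡-T {false} refl = _
≡-T {true}  refl = _

T-≢ : ∀ {β b} → T (β xor b) → β ≢ b
T-≢ {false} () refl
T-≢ {true}  () refl

≢-T : ∀ {β b} → β ≢ b → T (β xor b)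
≢-T {false} {false} β≢b = β≢b refl
≢-T {false} {true}  _   = _
≢-T {true}  {false} _   = _
≢-T {true}  {true}  β≢b = β≢b refl

permits⇔ : ∀ j s β b → T (permits (suc s ∸ j) β b) ⇔ ((j < s → β ≡ b) × (j ≡ s → β ≢ b))
permits⇔ j s β b with <-cmp j s
... | tri< j<s j≢s _ rewrite proj₂ (score>position j<s) =
  mk⇔ (λ ok → (λ _ → T-≡ ok) , λ j≡s → contradiction j≡s j≢s) (λ (eq , _) → ≡-T (eq j<s))
... | tri≈ j≮s refl _ rewrite score≡position j =
  mk⇔ (λ ok → (λ j<s → contradiction j<s j≮s) , λ _ → T-≢ ok) (λ (_ , neq) → ≢-T (neq refl))
... | tri> j≮s j≢s s<j rewrite m≤n⇒m∸n≡0 s<j =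
  mk⇔ (λ _ → (λ j<s → contradiction j<s j≮s) , λ j≡s → contradiction j≡s j≢s) _

-- `col` is any function on queries, so that `allTrue` and the `entry p` read by the program are
-- covered along with true columns.
allowed : (Vec Bool n → Bool) → History n t → ℕ → Bool → Bool
allowed col []            j b = true
allowed col ((x , s) ∷ H) j b = permits (suc (toℕ s) ∸ j) (col x) b ∧ allowed col H j b

column : Fin n → Vec Bool n → Bool
column p x = lookup x p

allowed-intro : (col : Vec Bool n → Bool) (H : History n t) (j : ℕ) (b : Bool) →
  (∀ i → T (permits (suc (toℕ (proj₂ (lookup H i))) ∸ j) (col (proj₁ (lookup H i))) b)) →
  T (allowed col H j b)
allowed-intro col []      j b ok = _
allowed-intro col (_ ∷ H) j b ok =
  Equivalence.from T-∧ (ok zero , allowed-intro col H j b (ok ∘ suc))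

allowed-elim : (col : Vec Bool n → Bool) (H : History n t) (j : ℕ) (b : Bool) →
  T (allowed col H j b) →
  ∀ i → T (permits (suc (toℕ (proj₂ (lookup H i))) ∸ j) (col (proj₁ (lookup H i))) b)
allowed-elim col (_ ∷ H) j b ok zero    = proj₁ (Equivalence.to T-∧ ok)
allowed-elim col (_ ∷ H) j b ok (suc i) =
  allowed-elim col H j b (proj₂ (Equivalence.to T-∧ ok)) i

Fits : History n t → Secret n → Set
Fits H (z , π) = ∀ j → T (allowed (column (π ⟨$⟩ʳ j)) H (toℕ j) (lookup z (π ⟨$⟩ʳ j)))

Consistent⇒Fits : (H : History n t) (s : Secret n) → Consistent s H → Fits H s
Consistent⇒Fits H s@(z , π) consistent j = allowed-intro _ H (toℕ j) _ λ i →
  Equivalence.from (permits⇔ _ _ _ _) (f≡⇒Matches s (proj₁ (lookup H i)) (consistent i) j)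

Fits⇒Consistent : (H : History n t) (s : Secret n) → Fits H s → Consistent s H
Fits⇒Consistent H s fits i = Matches⇒f≡ s (proj₁ (lookup H i)) λ j →
  Equivalence.to (permits⇔ _ _ _ _) (allowed-elim _ H (toℕ j) _ (fits j) i)

-- Bits allowed for a column that fitted earlier.

bit : Bool → ℕ
bit false = 0
bit true  = 1

weight : (Vec Bool n → Bool) → History n t → ℕ → ℕ
weight col H j = bit (allowed col H j false) + bit (allowed col H j true)

-- A reference column, which the history need not contain; its weight at j serves as w_j.
allTrue : Vec Bool n → Bool
allTrue _ = true

xor-table : ∀ b → b xor b ≡ false × b xor not b ≡ true
xor-table false = refl , refl
xor-table true  = refl , refl

-- A column p used before position j has x_p = b for all queries x that are
-- relevant at j, so up to renaming the bit it looks like the column of all ones.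
permits-later : ∀ {i j} s β b → i < j → T (permits (suc s ∸ i) β b) →
  permits (suc s ∸ j) β b ≡ permits (suc s ∸ j) true true ×
  permits (suc s ∸ j) β (not b) ≡ permits (suc s ∸ j) true false
permits-later {i} {j} s β b i<j ok with <-cmp s j
... | tri< s<j _ _ rewrite m≤n⇒m∸n≡0 s<j = refl , refl
... | tri≈ _ refl _
  rewrite score≡position j | proj₂ (score>position i<j) | T-≡ {β} {b} ok =
  xor-table b
... | tri> _ _ j<s
  rewrite proj₂ (score>position j<s) | proj₂ (score>position (<-trans i<j j<s)) | T-≡ {β} {b} ok =
  cong not (proj₁ (xor-table b)) , cong not (proj₂ (xor-table b))

allowed-later : (col : Vec Bool n → Bool) (H : History n t) {i j : ℕ} (b : Bool) →
  i < j → T (allowed col H i b) →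
  allowed col H j b ≡ allowed allTrue H j true ×
  allowed col H j (not b) ≡ allowed allTrue H j false
allowed-later col []            b i<j ok = refl , refl
allowed-later col ((x , s) ∷ H) b i<j ok =
  let ok₁ , ok₂ = Equivalence.to T-∧ ok
      same₁ , other₁ = permits-later (toℕ s) (col x) b i<j ok₁
      same₂ , other₂ = allowed-later col H b i<j ok₂
  in cong₂ _∧_ same₁ same₂ , cong₂ _∧_ other₁ other₂

-- Renaming the bit may swap the two summands of `weight`, which leaves their sum unchanged.
weight-later : (col : Vec Bool n → Bool) (H : History n t) {i j : ℕ} (b : Bool) →
  i < j → T (allowed col H i b) → weight col H j ≡ weight allTrue H j
weight-later col H false i<j ok =
  let same , other = allowed-later col H false i<j ok
  in trans (+-comm (bit (allowed col H _ false)) _) (cong₂ (λ a b → bit a + bit b) other same)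
weight-later col H true i<j ok =
  let same , other = allowed-later col H true i<j ok
  in cong₂ (λ a b → bit a + bit b) other same

-- Extensions of a valid sequence.

Choice : ℕ → Set
Choice n = Fin n × Bool

used : Vec (Choice n) m → Fin n → Bool
used []             p = false
used ((q , _) ∷ qs) p = does (p Fin.≟ q) ∨ used qs p

-- The entries of qs are the choices (π j , z_{π j}) in order of decreasing j.
extends : History n t → ℕ → Vec (Choice n) m → Choice n → Bool
extends H j qs (p , b) = not (used qs p) ∧ allowed (column p) H j b

Valid : History n t → Vec (Choice n) m → Set
Valid H []                   = ⊤
Valid {m = suc m} H (q ∷ qs) = T (extends H m qs q) × Valid H qs

-- Serves to mark one more column as used: its summand drops to 0 and the others stay.
sum-except : (g h : Fin n → ℕ) (p : Fin n) → g p ≡ 0 → (∀ q → q ≢ p → g q ≡ h q) →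
  sum g + h p ≡ sum h
sum-except {suc n} g h zero gp≡0 same rewrite gp≡0 =
  trans (+-comm (sum (g ∘ suc)) (h zero))
    (cong (h zero +_) (sum-cong-≗ λ q → same (suc q) λ ()))
sum-except {suc n} g h (suc p) gp≡0 same =
  trans (+-assoc (g zero) _ _)
    (cong₂ _+_ (same zero λ ())
      (sum-except (g ∘ suc) (h ∘ suc) p gp≡0 λ q q≢p → same (suc q) (q≢p ∘ Fin.suc-injective)))

extensionsAt : History n t → ℕ → Vec (Choice n) m → Fin n → ℕ
extensionsAt H j qs p = bit (extends H j qs (p , false)) + bit (extends H j qs (p , true))

extensionsAt-unused : (H : History n t) (j : ℕ) (qs : Vec (Choice n) m) (p : Fin n) →
  T (not (used qs p)) → extensionsAt H j qs p ≡ weight (column p) H j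
extensionsAt-unused H j qs p unused with used qs p
... | false = refl

-- Induction on the used columns with `j` fixed, hence `m ≤ j`. Each used column fitted at a
-- position below `j`, so striking it out removes exactly `weight allTrue H j`. The additive form
-- keeps truncated subtraction out of the induction.
extensions-later : (H : History n t) (j : ℕ) (qs : Vec (Choice n) m) → m ≤ j → Valid H qs →
  sum (extensionsAt H j qs) + m * weight allTrue H j ≡ sum (λ p → weight (column p) H j)
extensions-later H j [] _ _ = +-identityʳ _
extensions-later {m = suc m} H j ((p , b) ∷ qs) m<j (ok , valid) = begin
  sum (extensionsAt H j ((p , b) ∷ qs)) + (weight allTrue H j + m * weight allTrue H j)
    ≡⟨ +-assoc (sum (extensionsAt H j ((p , b) ∷ qs))) _ _ ⟨
  sum (extensionsAt H j ((p , b) ∷ qs)) + weight allTrue H j + m * weight allTrue H j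
    ≡⟨ cong (λ w → sum (extensionsAt H j ((p , b) ∷ qs)) + w + m * weight allTrue H j) new ⟨
  sum (extensionsAt H j ((p , b) ∷ qs)) + extensionsAt H j qs p + m * weight allTrue H j
    ≡⟨ cong (_+ m * weight allTrue H j) (sum-except _ _ p at-p other) ⟩
  sum (extensionsAt H j qs) + m * weight allTrue H j
    ≡⟨ extensions-later H j qs (<⇒≤ m<j) valid ⟩
  sum (λ p → weight (column p) H j) ∎
  where
  open ≡-Reasoning
  unused = proj₁ (Equivalence.to (T-∧ {not (used qs p)}) ok)

  new : extensionsAt H j qs p ≡ weight allTrue H j
  new = trans (extensionsAt-unused H j qs p unused)
    (weight-later (column p) H b m<j (proj₂ (Equivalence.to (T-∧ {not (used qs p)}) ok)))

  at-p : extensionsAt H j ((p , b) ∷ qs) p ≡ 0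
  at-p rewrite dec-true (p Fin.≟ p) refl = refl

  other : ∀ q → q ≢ p → extensionsAt H j ((p , b) ∷ qs) q ≡ extensionsAt H j qs q
  other q q≢p rewrite dec-false (q Fin.≟ p) q≢p = refl

-- Truncation does no harm: if a valid sequence of length `j` exists, the subtraction is exact by
-- `extensions-later`; if none exists, the product of the earlier factors is already 0.
factor : History n t → ℕ → ℕ
factor H j = sum (λ p → weight (column p) H j) ∸ j * weight allTrue H j

extensions-factor : (H : History n t) (qs : Vec (Choice n) m) → Valid H qs →
  sum (extensionsAt H m qs) ≡ factor H m
extensions-factor {m = m} H qs valid = trans (sym (m+n∸n≡m _ (m * weight allTrue H m)))
  (cong (_∸ m * weight allTrue H m) (extensions-later H m qs ≤-refl valid))

-- Enumeration of the valid sequences.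

choices : ∀ n → List (Choice n)
choices n = cartesianProduct (allFin n) (false ∷ true ∷ [])

choices-complete : (q : Choice n) → q ∈ choices n
choices-complete (p , false) = ∈-cartesianProduct⁺ (∈-allFin p) (here refl)
choices-complete (p , true)  = ∈-cartesianProduct⁺ (∈-allFin p) (there (here refl))

choices-unique : ∀ n → Unique (choices n)
choices-unique n = Unique.cartesianProduct⁺ (Unique.allFin⁺ n) (((λ ()) ∷ []) ∷ [] ∷ [])

length-filter-∷ : ∀ {A : Set} (ok : A → Bool) x xs →
  length (filter (T? ∘ ok) (x ∷ xs)) ≡ bit (ok x) + length (filter (T? ∘ ok) xs)
length-filter-∷ ok x xs with ok x
... | false = refl
... | true  = refl

-- Generalised to `tabulate g` for the induction, since the tail of `allFin (suc n)` is not itself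
-- an `allFin`.
length-choices : ∀ {A : Set} {n} (ok : A × Bool → Bool) (g : Fin n → A) →
  length (filter (T? ∘ ok) (cartesianProduct (List.tabulate g) (false ∷ true ∷ []))) ≡
  sum (λ i → bit (ok (g i , false)) + bit (ok (g i , true)))
length-choices {n = zero}  ok g = refl
length-choices {n = suc n} ok g = begin
  length (filter (T? ∘ ok) ((g zero , false) ∷ (g zero , true) ∷ rest))
    ≡⟨ length-filter-∷ ok _ _ ⟩
  bit (ok (g zero , false)) + length (filter (T? ∘ ok) ((g zero , true) ∷ rest))
    ≡⟨ cong (bit (ok (g zero , false)) +_) (length-filter-∷ ok _ _) ⟩
  bit (ok (g zero , false)) + (bit (ok (g zero , true)) + length (filter (T? ∘ ok) rest))
    ≡⟨ +-assoc (bit (ok (g zero , false))) _ _ ⟨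
  bit (ok (g zero , false)) + bit (ok (g zero , true)) + length (filter (T? ∘ ok) rest)
    ≡⟨ cong (bit (ok (g zero , false)) + bit (ok (g zero , true)) +_) (length-choices ok (g ∘ suc)) ⟩
  sum (λ i → bit (ok (g i , false)) + bit (ok (g i , true))) ∎
  where
  open ≡-Reasoning
  rest = cartesianProduct (List.tabulate (g ∘ suc)) (false ∷ true ∷ [])

extensions : History n t → Vec (Choice n) m → List (Vec (Choice n) (suc m))
extensions {m = m} H qs = map (_∷ qs) (filter (T? ∘ extends H m qs) (choices _))

validSequences : History n t → ∀ m → List (Vec (Choice n) m)
validSequences H zero    = [] ∷ []
validSequences H (suc m) = concatMap (extensions H) (validSequences H m)

∈⇒Valid : (H : History n t) {qs : Vec (Choice n) m} → qs ∈ validSequences H m → Valid H qs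
∈⇒Valid {m = zero}  H (here refl) = _
∈⇒Valid {m = suc m} H {qs} qs∈ with find (∈-concatMap⁻ (extensions H) {xs = validSequences H m} qs∈)
... | qs′ , qs′∈ , qs∈′ with ∈-map⁻ (_∷ qs′) qs∈′
... | q , q∈ , refl = proj₂ (∈-filter⁻ (T? ∘ extends H m qs′) {xs = choices _} q∈) , ∈⇒Valid H qs′∈

Valid⇒∈ : (H : History n t) (qs : Vec (Choice n) m) → Valid H qs → qs ∈ validSequences H m
Valid⇒∈ H []       _            = here refl
Valid⇒∈ {m = suc m} H (q ∷ qs) (ok , valid) = ∈-concatMap⁺ (extensions H)
  (lose (Valid⇒∈ H qs valid) (∈-map⁺ (_∷ qs) (∈-filter⁺ (T? ∘ extends H m qs) (choices-complete q) ok)))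

extensions-disjoint : (H : History n t) {qs qs′ : Vec (Choice n) m} → qs ≢ qs′ →
  Disjoint (extensions H qs) (extensions H qs′)
extensions-disjoint H {qs} {qs′} qs≢qs′ (∈₁ , ∈₂)
  with ∈-map⁻ (_∷ qs) ∈₁ | ∈-map⁻ (_∷ qs′) ∈₂
... | _ , _ , refl | _ , _ , refl = qs≢qs′ refl

validSequences-unique : (H : History n t) (m : ℕ) → Unique (validSequences H m)
validSequences-unique H zero    = [] ∷ []
validSequences-unique {n} H (suc m) = Unique.concat⁺
  (All.map⁺ (All.universal (λ qs → Unique.map⁺ (λ { refl → refl })
    (Unique.filter⁺ (T? ∘ extends H m qs) (choices-unique n))) (validSequences H m)))
  (AllPairs.map⁺ (AllPairs.map (extensions-disjoint H) (validSequences-unique H m)))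

numberOfSequences : History n t → ℕ → ℕ
numberOfSequences H zero    = 1
numberOfSequences H (suc m) = numberOfSequences H m * factor H m

length-concatMap : ∀ {A B : Set} (g : A → List B) {k xs} →
  All (λ x → length (g x) ≡ k) xs → length (concatMap g xs) ≡ length xs * k
length-concatMap g []                     = refl
length-concatMap g {xs = x ∷ xs} (eq ∷ eqs) =
  trans (length-++ (g x)) (cong₂ _+_ eq (length-concatMap g eqs))

length-extensions : (H : History n t) (qs : Vec (Choice n) m) → Valid H qs →
  length (extensions H qs) ≡ factor H m
length-extensions {n} {m = m} H qs valid = trans (length-map (_∷ qs) (filter (T? ∘ extends H m qs) (choices n)))
  (trans (length-choices (extends H m qs) id) (extensions-factor H qs valid))

length-validSequences : (H : History n t) (m : ℕ) →
  length (validSequences H m) ≡ numberOfSequences H m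
length-validSequences H zero    = refl
length-validSequences H (suc m) = trans
  (length-concatMap (extensions H) {xs = validSequences H m} (All.tabulate λ qs∈ → length-extensions H _ (∈⇒Valid H qs∈)))
  (cong (_* factor H m) (length-validSequences H m))

-- Valid sequences correspond to consistent secrets.

Valid⇒allowed : (H : History n t) (qs : Vec (Choice n) m) → Valid H qs → ∀ i →
  let p , b = lookup qs i in T (allowed (column p) H (m ∸ suc (toℕ i)) b)
Valid⇒allowed H ((p , b) ∷ qs) (ok , _) zero =
  proj₂ (Equivalence.to (T-∧ {not (used qs p)}) ok)
Valid⇒allowed H (_ ∷ qs) (_ , valid) (suc i) = Valid⇒allowed H qs valid i

used-complete : (qs : Vec (Choice n) m) (i : Fin m) → used qs (proj₁ (lookup qs i)) ≡ true
used-complete ((p , _) ∷ qs) zero rewrite dec-true (p Fin.≟ p) refl = refl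
used-complete ((p , _) ∷ qs) (suc i) rewrite used-complete qs i = ∨-zeroʳ _

used-sound : (qs : Vec (Choice n) m) (p : Fin n) → (∀ i → proj₁ (lookup qs i) ≢ p) →
  used qs p ≡ false
used-sound []             p new = refl
used-sound ((q , _) ∷ qs) p new
  rewrite dec-false (p Fin.≟ q) (new zero ∘ sym) = used-sound qs p (new ∘ suc)

unused⇒≢ : (qs : Vec (Choice n) m) {p : Fin n} → T (not (used qs p)) →
  ∀ i → proj₁ (lookup qs i) ≢ p
unused⇒≢ qs unused i refl rewrite used-complete qs i = unused

Valid⇒injective : (H : History n t) (qs : Vec (Choice n) m) → Valid H qs →
  Injective _≡_ _≡_ (proj₁ ∘ lookup qs)
Valid⇒injective H (_ ∷ _) _ {zero} {zero} _ = refl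
Valid⇒injective H ((p , _) ∷ qs) (ok , _) {zero} {suc i} eq =
  contradiction (sym eq) (unused⇒≢ qs (proj₁ (Equivalence.to (T-∧ {not (used qs p)}) ok)) i)
Valid⇒injective H ((p , _) ∷ qs) (ok , _) {suc i} {zero} eq =
  contradiction eq (unused⇒≢ qs (proj₁ (Equivalence.to (T-∧ {not (used qs p)}) ok)) i)
Valid⇒injective H (_ ∷ qs) (_ , valid) {suc i} {suc j} eq =
  cong suc (Valid⇒injective H qs valid eq)

Valid-intro : (H : History n t) (qs : Vec (Choice n) m) → Injective _≡_ _≡_ (proj₁ ∘ lookup qs) →
  (∀ i → let p , b = lookup qs i in T (allowed (column p) H (m ∸ suc (toℕ i)) b)) → Valid H qs
Valid-intro H []             inj ok = _
Valid-intro H ((p , b) ∷ qs) inj ok =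
  Equivalence.from T-∧ (subst (T ∘ not) (sym unused) _ , ok zero) ,
  Valid-intro H qs (Fin.suc-injective ∘ inj) (ok ∘ suc)
  where
  unused : used qs p ≡ false
  unused = used-sound qs p λ i eq → contradiction (inj {suc i} {zero} eq) λ ()

-- Pigeonhole: were `y` missed, punching it out would turn `g` into an injection into a smaller
-- `Fin`.
injective⇒surjective : (g : Fin n → Fin n) → Injective _≡_ _≡_ g → ∀ y → ∃[ x ] g x ≡ y
injective⇒surjective {suc n} g inj y with Fin.any? (λ x → g x Fin.≟ y)
... | yes found = found
... | no ¬found = contradiction
  (Fin.injective⇒≤ {f = λ x → punchOut {i = y} {j = g x} (λ eq → ¬found (x , sym eq))}
    (inj ∘ Fin.punchOut-injective {i = y} _ _)) 1+n≰n

injection⇒permutation : (g : Fin n → Fin n) → Injective _≡_ _≡_ g → Permutation′ n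
injection⇒permutation g inj = permutation g (proj₁ ∘ surj) (proj₂ ∘ surj)
  (λ x → inj (proj₂ (surj (g x))))
  where surj = injective⇒surjective g inj

opposite-injective : ∀ {i j : Fin n} → opposite i ≡ opposite j → i ≡ j
opposite-injective {i = i} {j} eq =
  trans (sym (Fin.opposite-involutive i)) (trans (cong opposite eq) (Fin.opposite-involutive j))

module _ (H : History n t) where

  place : Vec (Choice n) n → Fin n → Fin n
  place qs j = proj₁ (lookup qs (opposite j))

  decode : (qs : Vec (Choice n) n) → Valid H qs → Secret n
  decode qs valid = tabulate (λ p → proj₂ (lookup qs (opposite (π ⟨$⟩ˡ p)))) , π
    where π = injection⇒permutation (place qs) (opposite-injective ∘ Valid⇒injective H qs valid)

  decode-bit : ∀ qs (valid : Valid H qs) j →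
    lookup (proj₁ (decode qs valid)) (place qs j) ≡ proj₂ (lookup qs (opposite j))
  decode-bit qs valid j = trans (lookup∘tabulate _ (place qs j))
    (cong (proj₂ ∘ lookup qs ∘ opposite) (inverseˡ (proj₂ (decode qs valid))))

  decode-consistent : ∀ qs (valid : Valid H qs) → Consistent (decode qs valid) H
  decode-consistent qs valid = Fits⇒Consistent H (decode qs valid) fits
    where
    fits : Fits H (decode qs valid)
    fits j rewrite decode-bit qs valid j = subst
      (λ k → T (allowed (column (place qs j)) H k (proj₂ (lookup qs (opposite j)))))
      -- The entry at index `opposite j` was chosen for position `n ∸ suc (toℕ (opposite j))`, which
      -- is `toℕ j`.
      (trans (sym (Fin.opposite-prop (opposite j))) (cong toℕ (Fin.opposite-involutive j)))
      (Valid⇒allowed H qs valid (opposite j))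

  choiceAt : Secret n → Fin n → Choice n
  choiceAt (z , π) i = π ⟨$⟩ʳ opposite i , lookup z (π ⟨$⟩ʳ opposite i)

  encode : Secret n → Vec (Choice n) n
  encode s = tabulate (choiceAt s)

  encode-valid : ∀ s → Consistent s H → Valid H (encode s)
  encode-valid s@(z , π) consistent = Valid-intro H (encode s) inj ok
    where
    inj : Injective _≡_ _≡_ (proj₁ ∘ lookup (encode s))
    inj {i} {j} eq rewrite lookup∘tabulate (choiceAt s) i | lookup∘tabulate (choiceAt s) j =
      opposite-injective (trans (sym (inverseˡ π)) (trans (cong (π ⟨$⟩ˡ_) eq) (inverseˡ π)))

    ok : ∀ i → let p , b = lookup (encode s) i in T (allowed (column p) H (n ∸ suc (toℕ i)) b)
    ok i rewrite lookup∘tabulate (choiceAt s) i | sym (Fin.opposite-prop i) =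
      Consistent⇒Fits H s consistent (opposite i)

  encode-cong : ∀ {s s′ : Secret n} → Setoid._≈_ (secretSetoid n) s s′ → encode s ≡ encode s′
  encode-cong {z , π} {_ , π′} (refl , π≗π′) =
    tabulate-cong λ i → cong (λ p → p , lookup z p) (π≗π′ (opposite i))

  encode-decode : ∀ qs (valid : Valid H qs) → encode (decode qs valid) ≡ qs
  encode-decode qs valid = trans
    (tabulate-cong λ i → trans
      (cong (place qs (opposite i) ,_) (decode-bit qs valid (opposite i)))
      (cong (lookup qs) (Fin.opposite-involutive i)))
    (tabulate∘lookup qs)

  -- `qs` is a variable with an equation because it will be an entry looked up in the enumeration,
  -- with its own proof of validity, and equals `encode s` only propositionally.
  decode-encode : ∀ s qs (valid : Valid H qs) → qs ≡ encode s →
    Setoid._≈_ (secretSetoid n) (decode qs valid) s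
  decode-encode s@(z , π) qs valid refl = z′≡z , place≗π
    where
    π′ = proj₂ (decode qs valid)

    place≗π : ∀ j → place qs j ≡ π ⟨$⟩ʳ j
    place≗π j = trans (cong proj₁ (lookup∘tabulate (choiceAt s) (opposite j)))
      (cong (π ⟨$⟩ʳ_) (Fin.opposite-involutive j))

    z′≡z : proj₁ (decode qs valid) ≡ z
    z′≡z = trans (tabulate-cong λ p → trans
        (cong proj₂ (lookup∘tabulate (choiceAt s) (opposite (π′ ⟨$⟩ˡ p))))
        (cong (lookup z) (trans
          (sym (cong proj₁ (lookup∘tabulate (choiceAt s) (opposite (π′ ⟨$⟩ˡ p)))))
          (inverseʳ π′))))
      (tabulate∘lookup z)

lookup-injective : ∀ {A : Set} {xs : List A} → Unique xs → ∀ i j →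
  List.lookup xs i ≡ List.lookup xs j → i ≡ j
lookup-injective (_ ∷ _)      zero    zero    _  = refl
lookup-injective (x≢ ∷ _)     zero    (suc j) eq = contradiction eq (All.lookup x≢ (∈-lookup j))
lookup-injective (x≢ ∷ _)     (suc i) zero    eq = contradiction (sym eq) (All.lookup x≢ (∈-lookup i))
lookup-injective (_ ∷ unique) (suc i) (suc j) eq = cong suc (lookup-injective unique i j eq)

count : History n t → ℕ
count {n} H = numberOfSequences H n

consistentSecrets-cardinality : (H : History n t) → HasCardinality (consistentSecrets H) (count H)
consistentSecrets-cardinality {n} H =
  subst (HasCardinality (consistentSecrets H)) (length-validSequences H n) record
    { to        = λ i → decode H (List.lookup seqs i) (valid i) , decode-consistent H _ (valid i)
    ; from      = λ (s , consistent) → index (member s consistent)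
    ; to-cong   = λ { refl → refl , λ _ → refl }
    ; from-cong = λ {(s , c)} {(s′ , c′)} s≈s′ → lookup-injective unique _ _
        (trans (sym (lookup-index (member s c)))
          (trans (encode-cong H {s} {s′} s≈s′) (lookup-index (member s′ c′))))
    ; inverse   =
        (λ { {s , c} refl → decode-encode H s _ _ (sym (lookup-index (member s c))) }) ,
        (λ {i} {(s , c)} s≈ → lookup-injective unique _ _ (trans (sym (lookup-index (member s c)))
          (trans (encode-cong H {s} {decode H (List.lookup seqs i) (valid i)} s≈)
            (encode-decode H _ (valid i)))))
    }
  where
  seqs = validSequences H n
  unique = validSequences-unique H n
  valid = λ i → ∈⇒Valid H (∈-lookup {xs = seqs} i)
  member : ∀ s → Consistent s H → encode H s ∈ seqs
  member s c = Valid⇒∈ H (encode H s) (encode-valid H s c)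

-- Computing the count

iterate-+ : ∀ {A : Set} (g : A → A) x m k → iterate g x (m + k) ≡ iterate g (iterate g x m) k
iterate-+ g x zero    k = refl
iterate-+ g x (suc m) k = iterate-+ g (g x) m k

iterate-* : ∀ {A : Set} {g h : A → A} {k} → (∀ x → h x ≡ iterate g x k) →
  ∀ m x → iterate h x m ≡ iterate g x (m * k)
iterate-* h≗gᵏ zero x = refl
iterate-* {g = g} {h} {k} h≗gᵏ (suc m) x =
  trans (iterate-* h≗gᵏ m (h x))
    (trans (cong (λ y → iterate g y (m * k)) (h≗gᵏ x)) (sym (iterate-+ g x k (m * k))))

iterate-fixed : ∀ {A : Set} (g : A → A) {y} → g y ≡ y → ∀ m → iterate g y m ≡ y
iterate-fixed g fixed zero    = refl
iterate-fixed g fixed (suc m) = trans (cong (λ x → iterate g x m) fixed) (iterate-fixed g fixed m)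

iterate-settled : ∀ {A : Set} (g : A → A) {x y k m} →
  iterate g x k ≡ y → g y ≡ y → k ≤ m → iterate g x m ≡ y
iterate-settled g {x} {y} {k} {m} reached fixed k≤m = begin
  iterate g x m                     ≡⟨ cong (iterate g x) (m+[n∸m]≡n k≤m) ⟨
  iterate g x (k + (m ∸ k))         ≡⟨ iterate-+ g x k (m ∸ k) ⟩
  iterate g (iterate g x k) (m ∸ k) ≡⟨ cong (λ z → iterate g z (m ∸ k)) reached ⟩
  iterate g y (m ∸ k)               ≡⟨ iterate-fixed g fixed (m ∸ k) ⟩
  y                                 ∎
  where open ≡-Reasoning

-- The cube is forced by the bound 1 + 2 n² on the length of the product: for `t` equal to 0 and
-- large `n` it exceeds `L * L`.
capacity : ℕ → ℕ
capacity L = L * (L * L)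

rep³ : Fun → Fun
rep³ f = rep (rep (rep f))

run-rep³ : ∀ f L x → run (rep³ f) L x ≡ iterate (run f L) x (capacity L)
run-rep³ f L = iterate-* (iterate-* {g = run f L} {k = L} (λ _ → refl) L) L

size : Tree → ℕ
size nil     = 0
size (_ ∙ r) = suc (size r)

foldTree : (Tree → Tree → Tree) → Tree → Tree → Tree
foldTree g nil     acc = acc
foldTree g (x ∙ r) acc = foldTree g r (g x acc)

-- In the body of a loop these are the current list element and the accumulator,
-- and hd arg is the value of arg outside the loop.
item acc : Fun
item = hd (tl arg)
acc  = tl (tl arg)

-- The state is context, remaining list and accumulator, so `item` in the test is the remaining
-- list. Once that is `nil` the state is fixed, as `iterate-settled` demands.
foldBody : Fun → Fun
foldBody step =
  cond item (cons (hd arg) (cons (tl item) (cons (hd arg) (cons (hd item) acc) ⟫ step))) arg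

foldF : Fun → Fun → Fun → Fun
foldF list init step = cons arg (cons list init) ⟫ rep³ (foldBody step) ⟫ acc

foldBody-iterate : ∀ step L a xs y →
  iterate (run (foldBody step) L) (a ∙ xs ∙ y) (size xs) ≡
  a ∙ nil ∙ foldTree (λ x y → run step L (a ∙ x ∙ y)) xs y
foldBody-iterate step L a nil     y = refl
foldBody-iterate step L a (x ∙ r) y = foldBody-iterate step L a r _

run-fold : ∀ list init step L a {xs} → run list L a ≡ xs → size xs ≤ capacity L →
  run (foldF list init step) L a ≡
  foldTree (λ x y → run step L (a ∙ x ∙ y)) xs (run init L a)
run-fold list init step L a {xs} refl fits = cong (tail ∘ tail) (trans
  (run-rep³ (foldBody step) L _)
  (iterate-settled (run (foldBody step) L) (foldBody-iterate step L a xs _) refl fits))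

size-unary : ∀ k → size (unary k) ≡ k
size-unary zero    = refl
size-unary (suc k) = cong suc (size-unary k)

-- The unary `k` acts as the list of the fold, that is, as a counter. As `tail nil` is `nil`, this
-- both reaches the entries of a query and computes `∸` on unary numbers.
dropF : Fun → Fun → Fun
dropF k x = foldF k x (tl acc)

dropTree : ℕ → Tree → Tree
dropTree zero    x = x
dropTree (suc k) x = dropTree k (tail x)

run-drop : ∀ k x L {a m} → run k L a ≡ unary m → m ≤ capacity L →
  run (dropF k x) L a ≡ dropTree m (run x L a)
run-drop k x L {a} {m} k≡m fits =
  trans (run-fold k x (tl acc) L a k≡m (subst (_≤ capacity L) (sym (size-unary m)) fits))
    (unroll m (run x L a))
  where
  unroll : ∀ m y → foldTree (λ _ → tail) (unary m) y ≡ dropTree m y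
  unroll zero    y = refl
  unroll (suc m) y = unroll m (tail y)

dropTree-nil : ∀ k → dropTree k nil ≡ nil
dropTree-nil zero    = refl
dropTree-nil (suc k) = dropTree-nil k

dropTree-unary : ∀ k m → dropTree k (unary m) ≡ unary (m ∸ k)
dropTree-unary zero    m       = refl
dropTree-unary (suc k) zero    = dropTree-nil k
dropTree-unary (suc k) (suc m) = dropTree-unary k m

-- Testing a column against the history.

entry : ℕ → Vec Bool n → Bool
entry p       []      = false
entry zero    (b ∷ x) = b
entry (suc p) (b ∷ x) = entry p x

-- Holds for every `p`, because the default `false` of `entry` is encoded by `nil`, the value of
-- `head nil`.
head-dropTree : ∀ p (x : Vec Bool n) → head (dropTree p (encodeVec encodeBool x)) ≡ encodeBool (entry p x)
head-dropTree p       []      = cong head (dropTree-nil p)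
head-dropTree zero    (b ∷ x) = refl
head-dropTree (suc p) (b ∷ x) = head-dropTree p x

entry-lookup : ∀ (p : Fin n) x → entry (toℕ p) x ≡ column p x
entry-lookup zero    (b ∷ x) = refl
entry-lookup (suc p) (b ∷ x) = entry-lookup p x

true′ : Fun
true′ = cons nil nil

-- Treats both bits at once: the last component is the pair of verdicts for `false` and `true`, and
-- a query either keeps both or clears one.
permitF : Fun
permitF = cond (hd arg) (cond (tl (hd arg)) (cond β only₁ only₀) (cond β only₀ only₁)) oks
  where
  β = hd (tl arg)
  oks = tl (tl arg)
  only₀ = cons (hd oks) nil
  only₁ = cons nil (tl oks)

run-permit : ∀ L r β a b →
  run permitF L (unary r ∙ encodeBool β ∙ encodeBool a ∙ encodeBool b) ≡
  encodeBool (a ∧ permits r β false) ∙ encodeBool (b ∧ permits r β true)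
run-permit L zero          β     a b rewrite ∧-identityʳ a | ∧-identityʳ b = refl
run-permit L (suc zero)    false a b rewrite ∧-zeroʳ a | ∧-identityʳ b = refl
run-permit L (suc zero)    true  a b rewrite ∧-identityʳ a | ∧-zeroʳ b = refl
run-permit L (suc (suc r)) false a b rewrite ∧-identityʳ a | ∧-zeroʳ b = refl
run-permit L (suc (suc r)) true  a b rewrite ∧-zeroʳ a | ∧-identityʳ b = refl

-- On p ∙ j ∙ n ∙ H, the pair of bits allowed at position j for the column that
-- entryF extracts.
queryF : Fun → Fun
queryF entryF =
  cons (dropF (hd (tl (hd arg))) (cons nil (tl item))) (cons entryF acc) ⟫ permitF

allowedF : Fun → Fun
allowedF entryF = foldF (tl (tl (tl arg))) (cons true′ true′) (queryF entryF)

encodeQuery : Vec Bool n × Fin (suc n) → Tree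
encodeQuery (x , s) = encodeVec encodeBool x ∙ unary (toℕ s)

-- Abstracts from the reader of the column: `entryF` reads true columns, and `true′` plays
-- `allTrue`.
Extracts : ∀ {n} → Fun → ℕ → Tree → (Vec Bool n → Bool) → Set
Extracts entryF L a col = ∀ x s y →
  run entryF L (a ∙ encodeQuery (x , s) ∙ y) ≡ encodeBool (col x)

run-query : ∀ entryF L P j B {col : Vec Bool n → Bool} →
  Extracts entryF L (P ∙ unary j ∙ B) col → j ≤ capacity L → ∀ x s a b →
  run (queryF entryF) L
    ((P ∙ unary j ∙ B) ∙ encodeQuery (x , s) ∙ encodeBool a ∙ encodeBool b) ≡
  encodeBool (a ∧ permits (suc (toℕ s) ∸ j) (col x) false) ∙
  encodeBool (b ∧ permits (suc (toℕ s) ∸ j) (col x) true)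
run-query entryF L P j B {col} extracts j≤ x s a b = trans
  (cong₂ (λ r β → run permitF L (r ∙ β ∙ encodeBool a ∙ encodeBool b))
    -- `cons nil (tl item)` is `suc s` in unary, so dropping `j` cells leaves the number that
    -- `permits` expects.
    (trans (run-drop (hd (tl (hd arg))) (cons nil (tl item)) L refl j≤) (dropTree-unary j (suc (toℕ s))))
    (extracts x s _))
  (run-permit L (suc (toℕ s) ∸ j) (col x) a b)

size-encodeVec : ∀ {A : Set} {k} (enc : A → Tree) (xs : Vec A k) → size (encodeVec enc xs) ≡ k
size-encodeVec enc []       = refl
size-encodeVec enc (x ∷ xs) = cong suc (size-encodeVec enc xs)

run-allowed : ∀ entryF L P j N {col : Vec Bool n → Bool} (H : History n t) →
  let a = P ∙ unary j ∙ N ∙ encodeVec encodeQuery H in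
  Extracts entryF L a col → j ≤ capacity L → t ≤ capacity L →
  run (allowedF entryF) L a ≡
  encodeBool (allowed col H j false) ∙ encodeBool (allowed col H j true)
run-allowed {n} entryF L P j N {col} H extracts j≤ t≤ = trans
  (run-fold (tl (tl (tl arg))) (cons true′ true′) (queryF entryF) L _ refl
    (subst (_≤ capacity L) (sym (size-encodeVec encodeQuery H)) t≤))
  (unroll H true true)
  where
  A = P ∙ unary j ∙ N ∙ encodeVec encodeQuery H
  unroll : ∀ {k} (G : History n k) a b →
    foldTree (λ x y → run (queryF entryF) L (A ∙ x ∙ y)) (encodeVec encodeQuery G)
      (encodeBool a ∙ encodeBool b) ≡
    encodeBool (a ∧ allowed col G j false) ∙ encodeBool (b ∧ allowed col G j true)
  unroll [] a b rewrite ∧-identityʳ a | ∧-identityʳ b = refl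
  unroll ((x , s) ∷ G) a b = trans
    (cong (foldTree _ (encodeVec encodeQuery G)) (run-query entryF L P j _ extracts j≤ x s a b))
    (trans (unroll G _ _) (cong₂ (λ a b → encodeBool a ∙ encodeBool b)
      (∧-assoc a _ _) (∧-assoc b _ _)))

-- The factor of a position, in unary.

tallyF : Fun
tallyF = cons (hd arg) (when (tl (hd arg))) ⟫ when (hd (hd arg))
  where when = λ b → cond b (cons nil (tl arg)) (tl arg)

run-tally : ∀ L a b c →
  run tallyF L ((encodeBool a ∙ encodeBool b) ∙ unary c) ≡ unary (c + (bit a + bit b))
run-tally L a b c = trans (by-cases a b) (cong unary (+-comm (bit a + bit b) c))
  where
  by-cases : ∀ a b → run tallyF L ((encodeBool a ∙ encodeBool b) ∙ unary c) ≡ unary (bit a + bit b + c)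
  by-cases false false = refl
  by-cases false true  = refl
  by-cases true  false = refl
  by-cases true  true  = refl

entryF : Fun
entryF = hd (dropF (hd (hd arg)) (hd item))

-- On j ∙ n ∙ H; the accumulator is the next column and the sum so far.
columnF : Fun
columnF = cons (cons nil (hd acc)) (cons (cons (hd acc) (hd arg) ⟫ allowedF entryF) (tl acc) ⟫ tallyF)

totalF : Fun
totalF = foldF (hd (tl arg)) (cons nil nil) columnF ⟫ tl arg

sumFrom : (ℕ → ℕ) → ℕ → ℕ → ℕ
sumFrom g p zero    = 0
sumFrom g p (suc k) = g p + sumFrom g (suc p) k

sumFrom-sum : ∀ g p k → sumFrom g p k ≡ sum {k} (λ i → g (p + toℕ i))
sumFrom-sum g p zero    = refl
sumFrom-sum g p (suc k) = cong₂ _+_ (cong g (sym (+-identityʳ p)))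
  (trans (sumFrom-sum g (suc p) k) (sum-cong-≗ {k} λ i → cong g (sym (+-suc p (toℕ i)))))

allowed-cong : {col col′ : Vec Bool n → Bool} → (∀ x → col x ≡ col′ x) →
  ∀ (H : History n t) j b → allowed col H j b ≡ allowed col′ H j b
allowed-cong same []            j b = refl
allowed-cong same ((x , s) ∷ H) j b =
  cong₂ _∧_ (cong (λ β → permits (suc (toℕ s) ∸ j) β b) (same x)) (allowed-cong same H j b)

totalWeight : History n t → ℕ → ℕ
totalWeight H j = sum λ p → weight (column p) H j

module _ (L : ℕ) (H : History n t) (j : ℕ)
         (n≤ : n ≤ capacity L) (t≤ : t ≤ capacity L) (j≤ : j ≤ capacity L) where

  private
    A = unary j ∙ encodeHistory H

  run-column : ∀ p c → p ≤ capacity L →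
    run columnF L (A ∙ nil ∙ unary p ∙ unary c) ≡
    unary (suc p) ∙ unary (c + weight (entry p) H j)
  run-column p c p≤ = cong (unary (suc p) ∙_) (trans
    (cong (λ o → run tallyF L (o ∙ unary c))
      (run-allowed entryF L (unary p) j (unary n) H
        (λ x s y → trans (cong head (run-drop (hd (hd arg)) (hd item) L refl p≤)) (head-dropTree p x)) j≤ t≤))
    (run-tally L (allowed (entry p) H j false) (allowed (entry p) H j true) c))

  columns-unroll : ∀ k p c → p + k ≤ capacity L →
    foldTree (λ x y → run columnF L (A ∙ x ∙ y)) (unary k) (unary p ∙ unary c) ≡
    unary (p + k) ∙ unary (c + sumFrom (λ p → weight (entry p) H j) p k)
  columns-unroll zero    p c _  = cong₂ (λ p c → unary p ∙ unary c) (sym (+-identityʳ p)) (sym (+-identityʳ c))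
  columns-unroll (suc k) p c p≤ = trans
    (cong (foldTree _ (unary k)) (run-column p c (≤-trans (m≤m+n p (suc k)) p≤)))
    (trans (columns-unroll k (suc p) _ (subst (_≤ capacity L) (+-suc p k) p≤))
      (cong₂ (λ p c → unary p ∙ unary c) (sym (+-suc p k)) (+-assoc c _ _)))

  run-total : run totalF L A ≡ unary (totalWeight H j)
  run-total = trans
    (cong tail (trans
      (run-fold (hd (tl arg)) (cons nil nil) columnF L A {unary n} refl
        (subst (_≤ capacity L) (sym (size-unary n)) n≤))
      (columns-unroll n 0 0 n≤)))
    (cong unary (trans (sumFrom-sum _ 0 n) (sum-cong-≗ {n} λ p →
      cong₂ (λ a b → bit a + bit b)
        (allowed-cong (entry-lookup p) H j false) (allowed-cong (entry-lookup p) H j true))))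

discountF : Fun → Fun
discountF b = cond b (dropF (hd arg) acc) acc

-- The product `j * weight allTrue H j` is never formed: the weight is a sum of two bits, so `j` is
-- subtracted once for each bit that is set.
factorF : Fun
factorF = cons (hd arg) (cons (cons nil arg ⟫ allowedF true′) totalF) ⟫
  cons (hd arg) (cons item (discountF (hd item))) ⟫ discountF (tl item)

run-discount : ∀ b L j m c {o} → j ≤ capacity L → run b L (unary j ∙ o ∙ unary m) ≡ encodeBool c →
  run (discountF b) L (unary j ∙ o ∙ unary m) ≡ unary (m ∸ j * bit c)
run-discount b L j m false j≤ eq rewrite eq | *-zeroʳ j = refl
run-discount b L j m true {o} j≤ eq rewrite eq | *-identityʳ j =
  trans (run-drop (hd arg) acc L {unary j ∙ o ∙ unary m} refl j≤) (dropTree-unary j m)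

run-factor : ∀ L (H : History n t) j → n ≤ capacity L → t ≤ capacity L → j ≤ capacity L →
  run factorF L (unary j ∙ encodeHistory H) ≡ unary (factor H j)
run-factor {n} {t} L H j n≤ t≤ j≤ = trans
  (cong₂ (λ o m → run rest L (unary j ∙ o ∙ m))
    (run-allowed true′ L nil j (unary n) H (λ x s y → refl) j≤ t≤)
    (run-total L H j n≤ t≤ j≤))
  (trans
    (cong (λ m → run (discountF (tl item)) L (unary j ∙ O ∙ m))
      (run-discount (hd item) L j M a₀ {O} j≤ refl))
    (trans (run-discount (tl item) L j (M ∸ j * bit a₀) a₁ {O} j≤ refl)
      (cong unary (trans (∸-+-assoc M (j * bit a₀) (j * bit a₁))
        (cong (M ∸_) (sym (*-distribˡ-+ j (bit a₀) (bit a₁))))))))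
  where
  rest = cons (hd arg) (cons item (discountF (hd item))) ⟫ discountF (tl item)
  M = totalWeight H j
  a₀ = allowed allTrue H j false
  a₁ = allowed allTrue H j true
  O = encodeBool a₀ ∙ encodeBool a₁

-- Addition of binary numerals.

digit : ℕᵇ → ℕ
digit Bin.zero = 0
digit 1+[2 _ ] = 1
digit 2[1+ _ ] = 2

-- Reading `zero` as digit 0 above `zero` pads the shorter summand; a nonzero numeral never has
-- digit 0.
higher : ℕᵇ → ℕᵇ
higher Bin.zero = Bin.zero
higher 1+[2 a ] = a
higher 2[1+ a ] = a

bits : ℕᵇ → ℕ
bits a = size (encodeBin a)

toℕ-digit : ∀ a → Bin.toℕ a ≡ digit a + 2 * Bin.toℕ (higher a)
toℕ-digit Bin.zero = refl
toℕ-digit 1+[2 a ] = refl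
toℕ-digit 2[1+ a ] = *-suc 2 (Bin.toℕ a)

bits-higher : ∀ a {m} → bits a ≤ suc m → bits (higher a) ≤ m
bits-higher Bin.zero _       = z≤n
bits-higher 1+[2 a ] (s≤s l) = l
bits-higher 2[1+ a ] (s≤s l) = l

push : Bool → ℕᵇ → ℕᵇ
push false a = 1+[2 a ]
push true  a = 2[1+ a ]

toℕ-push : ∀ d a → Bin.toℕ (push d a) ≡ suc (bit d) + 2 * Bin.toℕ a
toℕ-push false a = refl
toℕ-push true  a = *-suc 2 (Bin.toℕ a)

encode-push : ∀ d a → encodeBin (push d a) ≡ encodeBool d ∙ encodeBin a
encode-push false a = refl
encode-push true  a = refl

bits-push : ∀ d a → bits (push d a) ≡ suc (bits a)
bits-push d a rewrite encode-push d a = refl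

addDigitF : Fun → Fun → Fun
addDigitF a c = cond a (cons nil (cond (hd a) (cons nil c) c)) c

-- On s ∙ a ∙ b ∙ o with s a digit sum between 0 and 6: in bijective base 2 the
-- digit to emit is 1 or 2, so s = 1 + d + 2 c with d ≤ 1 and carry c ≤ 2.
emitF : Fun
emitF = cond (tail^ 0)
  (cons a (cons b (cons carry (cons even? o))))
  (cons a (cons b (cons nil o)))
  where
  tail^ : ℕ → Fun
  tail^ zero    = hd arg
  tail^ (suc k) = tl (tail^ k)
  a = hd (tl arg)
  b = hd (tl (tl arg))
  o = tl (tl (tl arg))
  carry = cond (tail^ 2) (cond (tail^ 4) (cons nil true′) true′) nil
  even? = cond (tail^ 1) (cond (tail^ 2) (cond (tail^ 3) (cond (tail^ 4)
    (cond (tail^ 5) true′ nil) true′) nil) true′) nil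

run-emit : ∀ L d c a b o → c ≤ 2 →
  run emitF L (unary (suc (bit d) + 2 * c) ∙ a ∙ b ∙ o) ≡ a ∙ b ∙ unary c ∙ encodeBool d ∙ o
run-emit L false 0 a b o _ = refl
run-emit L false 1 a b o _ = refl
run-emit L false 2 a b o _ = refl
run-emit L true  0 a b o _ = refl
run-emit L true  1 a b o _ = refl
run-emit L true  2 a b o _ = refl
run-emit L _ (suc (suc (suc _))) a b o (s≤s (s≤s ()))

-- Sum 0 means that both numerals are exhausted and no carry is left, so nothing is emitted.
data DigitSum : ℕ → Set where
  none : DigitSum 0
  emit : ∀ d c → c ≤ 2 → DigitSum (suc (bit d) + 2 * c)

digitSum : ∀ {s} → s ≤ 6 → DigitSum s
digitSum {0} _ = none
digitSum {1} _ = emit false 0 z≤n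
digitSum {2} _ = emit true 0 z≤n
digitSum {3} _ = emit false 1 (s≤s z≤n)
digitSum {4} _ = emit true 1 (s≤s z≤n)
digitSum {5} _ = emit false 2 (s≤s (s≤s z≤n))
digitSum {6} _ = emit true 2 (s≤s (s≤s z≤n))
digitSum {suc (suc (suc (suc (suc (suc (suc _))))))} (s≤s (s≤s (s≤s (s≤s (s≤s (s≤s ()))))))

addStepF : Fun
addStepF = cons (addDigitF (hd arg) (addDigitF item (hd acc)))
  (cons (tl (hd arg)) (cons (tl item) (tl acc))) ⟫ emitF

run-addStep : ∀ L a b c o →
  run addStepF L (encodeBin a ∙ encodeBin b ∙ unary c ∙ o) ≡
  run emitF L (unary (digit a + (digit b + c)) ∙ encodeBin (higher a) ∙ encodeBin (higher b) ∙ o)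
run-addStep L Bin.zero Bin.zero c o = refl
run-addStep L Bin.zero 1+[2 b ] c o = refl
run-addStep L Bin.zero 2[1+ b ] c o = refl
run-addStep L 1+[2 a ] Bin.zero c o = refl
run-addStep L 1+[2 a ] 1+[2 b ] c o = refl
run-addStep L 1+[2 a ] 2[1+ b ] c o = refl
run-addStep L 2[1+ a ] Bin.zero c o = refl
run-addStep L 2[1+ a ] 1+[2 b ] c o = refl
run-addStep L 2[1+ a ] 2[1+ b ] c o = refl

digit≤2 : ∀ a → digit a ≤ 2
digit≤2 Bin.zero = z≤n
digit≤2 1+[2 a ] = s≤s z≤n
digit≤2 2[1+ a ] = s≤s (s≤s z≤n)

_onto_ : Tree → Tree → Tree
x onto o = foldTree _∙_ x o

-- Carries stay at most 2, because the largest digit sum 6 is 2 + 2 * 2. Of the `suc m` rounds, `m`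
-- consume digits and one emits the last carry. The digits pile up on `o` in reverse order, and the
-- state reached is a fixed point.
add-iterate : ∀ L m a b c o → bits a ≤ m → bits b ≤ m → c ≤ 2 →
  ∃[ r ] Bin.toℕ r ≡ Bin.toℕ a + Bin.toℕ b + c × bits r ≤ suc m ×
    iterate (run addStepF L) (encodeBin a ∙ encodeBin b ∙ unary c ∙ o) (suc m) ≡
    nil ∙ nil ∙ nil ∙ (encodeBin r onto o)
add-iterate L zero Bin.zero Bin.zero 0 o _ _ _ = Bin.zero , refl , z≤n , refl
add-iterate L zero Bin.zero Bin.zero 1 o _ _ _ = push false Bin.zero , refl , s≤s z≤n , refl
add-iterate L zero Bin.zero Bin.zero 2 o _ _ _ = push true Bin.zero , refl , s≤s z≤n , refl
add-iterate L zero Bin.zero Bin.zero (suc (suc (suc _))) o _ _ (s≤s (s≤s ()))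
add-iterate L (suc m) a b c o a≤ b≤ c≤ = by-digitSum (digitSum sum≤6) refl
  where
  step = run addStepF L
  a′ = higher a
  b′ = higher b
  sum≤6 : digit a + (digit b + c) ≤ 6
  sum≤6 = +-mono-≤ (digit≤2 a) (+-mono-≤ (digit≤2 b) c≤)

  value : Bin.toℕ a + Bin.toℕ b + c ≡
    (digit a + (digit b + c)) + 2 * (Bin.toℕ a′ + Bin.toℕ b′)
  value = trans (cong₂ (λ x y → x + y + c) (toℕ-digit a) (toℕ-digit b))
    (rearrange (digit a) (digit b) c (Bin.toℕ a′) (Bin.toℕ b′))
    where
    rearrange : ∀ d e c x y → d + 2 * x + (e + 2 * y) + c ≡ (d + (e + c)) + 2 * (x + y)
    rearrange = solve-∀

  by-digitSum : ∀ {s} → DigitSum s → digit a + (digit b + c) ≡ s →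
    ∃[ r ] Bin.toℕ r ≡ Bin.toℕ a + Bin.toℕ b + c × bits r ≤ suc (suc m) ×
      iterate step (encodeBin a ∙ encodeBin b ∙ unary c ∙ o) (suc (suc m)) ≡
      nil ∙ nil ∙ nil ∙ (encodeBin r onto o)
  by-digitSum none eq =
    let r , r≡ , r≤ , reached = add-iterate L m a′ b′ 0 o (bits-higher a a≤) (bits-higher b b≤) z≤n
    in r , trans r≡ (trans (zero-sum (Bin.toℕ a′) (Bin.toℕ b′) even)
        (sym (trans value (cong (_+ 2 * (Bin.toℕ a′ + Bin.toℕ b′)) eq)))) ,
      ≤-trans r≤ (n≤1+n _) ,
      trans (cong (λ x → iterate step x (suc m)) (trans (run-addStep L a b c o)
        (cong (λ s → run emitF L (unary s ∙ encodeBin a′ ∙ encodeBin b′ ∙ o)) eq))) reached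
    where
    no-digit : ∀ a → digit a ≡ 0 → Bin.toℕ (higher a) ≡ 0
    no-digit Bin.zero _ = refl
    even : Bin.toℕ a′ + Bin.toℕ b′ ≡ 0
    even = cong₂ _+_ (no-digit a (m+n≡0⇒m≡0 (digit a) eq))
      (no-digit b (m+n≡0⇒m≡0 (digit b) (m+n≡0⇒n≡0 (digit a) eq)))
    zero-sum : ∀ x y → x + y ≡ 0 → x + y + 0 ≡ 2 * (x + y)
    zero-sum x y eq rewrite eq = refl
  by-digitSum (emit d c′ c′≤2) eq =
    let r , r≡ , r≤ , reached = add-iterate L m a′ b′ c′ (encodeBool d ∙ o)
          (bits-higher a a≤) (bits-higher b b≤) c′≤2
    in push d r ,
      trans (toℕ-push d r) (trans (cong (λ x → suc (bit d) + 2 * x) r≡)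
        (trans (rearrange (bit d) c′ (Bin.toℕ a′ + Bin.toℕ b′))
          (sym (trans value (cong (_+ 2 * (Bin.toℕ a′ + Bin.toℕ b′)) eq))))) ,
      ≤-trans (≤-reflexive (bits-push d r)) (s≤s r≤) ,
      trans (cong (λ x → iterate step x (suc m)) (trans (run-addStep L a b c o)
        (trans (cong (λ s → run emitF L (unary s ∙ encodeBin a′ ∙ encodeBin b′ ∙ o)) eq)
          (run-emit L d c′ (encodeBin a′) (encodeBin b′) o c′≤2))))
        (trans reached (cong (λ x → nil ∙ nil ∙ nil ∙ (x onto o)) (sym (encode-push d r))))
    where
    rearrange : ∀ d c x → suc d + 2 * (x + c) ≡ suc d + 2 * c + 2 * x
    rearrange = solve-∀

reverseF : Fun
reverseF = foldF arg nil (cons item acc)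

addF : Fun
addF = cons (hd arg) (cons (tl arg) (cons nil nil)) ⟫ rep³ addStepF ⟫ tl acc ⟫ reverseF

onto-onto : ∀ x y → (x onto y) onto nil ≡ y onto x
onto-onto nil     y = refl
onto-onto (a ∙ x) y = onto-onto x (a ∙ y)

size-onto : ∀ x y → size (x onto y) ≡ size x + size y
size-onto nil     y = refl
size-onto (a ∙ x) y = trans (size-onto x (a ∙ y)) (+-suc (size x) (size y))

run-reverse : ∀ L x → size x ≤ capacity L → run reverseF L x ≡ x onto nil
run-reverse L x fits = trans (run-fold arg nil (cons item acc) L x refl fits) (unroll x nil)
  where
  unroll : ∀ y z → foldTree (λ a b → run (cons item acc) L (x ∙ a ∙ b)) y z ≡ y onto z
  unroll nil     z = refl
  unroll (a ∙ y) z = unroll y (a ∙ z)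

run-add : ∀ L m a b → bits a ≤ m → bits b ≤ m → suc m ≤ capacity L →
  ∃[ r ] Bin.toℕ r ≡ Bin.toℕ a + Bin.toℕ b × bits r ≤ suc m ×
    run addF L (encodeBin a ∙ encodeBin b) ≡ encodeBin r
run-add L m a b a≤ b≤ fits =
  let r , r≡ , r≤ , reached = add-iterate L m a b 0 nil a≤ b≤ z≤n
      output≤ = subst (_≤ capacity L)
        (sym (trans (size-onto (encodeBin r) nil) (+-identityʳ (bits r)))) (≤-trans r≤ fits)
      settled = trans (run-rep³ addStepF L _) (iterate-settled (run addStepF L) reached refl fits)
  in r , trans r≡ (+-identityʳ _) , r≤ ,
    trans (cong (λ x → run reverseF L (tail (tail (tail x)))) settled)
      (trans (run-reverse L (encodeBin r onto nil) output≤) (onto-onto (encodeBin r) nil))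

-- On g ∙ a with g in unary: a is added g times.
timesF : Fun
timesF = foldF (hd arg) nil (cons (tl (hd arg)) acc ⟫ addF)

-- `m` bounds the accumulator as well as `a`, and grows by one with each addition.
times-unroll : ∀ L G a k r m → bits a ≤ m → bits r ≤ m → m + k ≤ capacity L →
  ∃[ r′ ] Bin.toℕ r′ ≡ k * Bin.toℕ a + Bin.toℕ r × bits r′ ≤ m + k ×
    foldTree (λ x y → run (cons (tl (hd arg)) acc ⟫ addF) L ((G ∙ encodeBin a) ∙ x ∙ y))
      (unary k) (encodeBin r) ≡ encodeBin r′
times-unroll L G a zero    r m a≤ r≤ fits = r , refl , ≤-trans r≤ (m≤m+n m 0) , refl
times-unroll L G a (suc k) r m a≤ r≤ fits =
  let fits′ = subst (_≤ capacity L) (+-suc m k) fits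
      s , s≡ , s≤ , added = run-add L m a r a≤ r≤ (≤-trans (m≤m+n (suc m) k) fits′)
      r′ , r′≡ , r′≤ , rest = times-unroll L G a k s (suc m) (m≤n⇒m≤1+n a≤) s≤ fits′
  in r′ , trans r′≡ (trans (cong (k * Bin.toℕ a +_) s≡) (rearrange (Bin.toℕ a) (Bin.toℕ r) k)) ,
    ≤-trans r′≤ (≤-reflexive (sym (+-suc m k))) ,
    trans (cong (foldTree _ (unary k)) added) rest
  where
  rearrange : ∀ a r k → k * a + (a + r) ≡ suc k * a + r
  rearrange = solve-∀

run-times : ∀ L g a m → bits a ≤ m → m + g ≤ capacity L →
  ∃[ r ] Bin.toℕ r ≡ Bin.toℕ a * g × bits r ≤ m + g ×
    run timesF L (unary g ∙ encodeBin a) ≡ encodeBin r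
run-times L g a m a≤ fits =
  let r , r≡ , r≤ , unrolled = times-unroll L (unary g) a g Bin.zero m a≤ z≤n fits
  in r , trans r≡ (trans (+-identityʳ _) (*-comm g (Bin.toℕ a))) , r≤ ,
    trans (run-fold (hd arg) nil (cons (tl (hd arg)) acc ⟫ addF) L (unary g ∙ encodeBin a) {unary g} refl
      (subst (_≤ capacity L) (sym (size-unary g)) (≤-trans (m≤n+m g m) fits))) unrolled

-- On an encoded history; the accumulator is the position and the product so far.
positionF : Fun
positionF = cons (cons nil (hd acc)) (cons (cons (hd acc) (hd arg) ⟫ factorF) (tl acc) ⟫ timesF)

countF : Fun
countF = foldF (hd arg) (cons nil true′) positionF ⟫ tl arg

sum-≤ : ∀ {c} k (g : Fin k → ℕ) → (∀ i → g i ≤ c) → sum g ≤ k * c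
sum-≤ zero    g g≤ = z≤n
sum-≤ (suc k) g g≤ = +-mono-≤ (g≤ zero) (sum-≤ k (g ∘ suc) (g≤ ∘ suc))

bit≤1 : ∀ b → bit b ≤ 1
bit≤1 false = z≤n
bit≤1 true  = s≤s z≤n

-- Limits the additions, and hence the new digits, that one position can cause.
factor≤2n : (H : History n t) (j : ℕ) → factor H j ≤ n * 2
factor≤2n {n} H j = ≤-trans (m∸n≤m (totalWeight H j) (j * weight allTrue H j))
  (sum-≤ n _ λ p → +-mono-≤ (bit≤1 (allowed (column p) H j false)) (bit≤1 (allowed (column p) H j true)))

-- `m` is the current digit bound, and each of the `k` positions left may add `n * 2` digits to it.
positions-unroll : ∀ L (H : History n t) → n ≤ capacity L → t ≤ capacity L →
  ∀ k j r m → j + k ≤ capacity L → bits r ≤ m → m + k * (n * 2) ≤ capacity L →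
  Bin.toℕ r ≡ numberOfSequences H j →
  ∃[ r′ ] Bin.toℕ r′ ≡ numberOfSequences H (j + k) ×
    tail (foldTree (λ x y → run positionF L (encodeHistory H ∙ x ∙ y)) (unary k) (unary j ∙ encodeBin r)) ≡
    encodeBin r′
positions-unroll L H n≤ t≤ zero j r m j≤ r≤ fits r≡ =
  r , trans r≡ (cong (numberOfSequences H) (sym (+-identityʳ j))) , refl
positions-unroll {n} L H n≤ t≤ (suc k) j r m j≤ r≤ fits r≡ =
  let fits′ = subst (_≤ capacity L) (sym (+-assoc m (n * 2) (k * (n * 2)))) fits
      factor-fits = ≤-trans (+-monoʳ-≤ m (factor≤2n H j)) (≤-trans (m≤m+n _ _) fits′)
      s , s≡ , s≤ , multiplied = run-times L (factor H j) r m r≤ factor-fits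
      step = trans
        (cong (λ g → run timesF L (g ∙ encodeBin r))
          (run-factor L H j n≤ t≤ (≤-trans (m≤m+n j (suc k)) j≤))) multiplied
      r′ , r′≡ , rest = positions-unroll L H n≤ t≤ k (suc j) s (m + n * 2)
        (subst (_≤ capacity L) (+-suc j k) j≤)
        (≤-trans s≤ (+-monoʳ-≤ m (factor≤2n H j))) fits′
        (trans s≡ (cong (_* factor H j) r≡))
  in r′ , trans r′≡ (cong (numberOfSequences H) (sym (+-suc j k))) ,
    trans (cong (λ y → tail (foldTree _ (unary k) (unary (suc j) ∙ y))) step) rest

-- The product has at most 1 + 2 n² binary digits, since adding lengthens the
-- longer summand by at most one digit and each factor is at most 2 n.
bits-fit : ∀ n t → 1 + n * (n * 2) ≤ capacity (clockLength n t)
bits-fit n t = begin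
  1 + n * (n * 2)             ≤⟨ m≤m+n _ _ ⟩
  1 + n * (n * 2) + (7 + 12 * n + 4 * (n * n) + n * (n * n))  ≡⟨ cube n ⟨
  capacity (2 + n)            ≤⟨ *-mono-≤ l (*-mono-≤ l l) ⟩
  capacity (clockLength n t)  ∎
  where
  open ≤-Reasoning
  l : 2 + n ≤ clockLength n t
  l = m≤n+m (2 + n) t
  cube : ∀ n → (2 + n) * ((2 + n) * (2 + n)) ≡ 1 + n * (n * 2) + (7 + 12 * n + 4 * (n * n) + n * (n * n))
  cube = solve-∀

L≤capacity : ∀ L → L ≤ capacity L
L≤capacity zero    = z≤n
L≤capacity (suc L) = m≤m*n (suc L) (suc L * suc L)

run-count : (H : History n t) →
  run countF (clockLength n t) (encodeHistory H) ≡ binary (count H)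
run-count {n} {t} H =
  let L = clockLength n t
      n≤ = ≤-trans (≤-trans (m≤n+m n 2) (m≤n+m (2 + n) t)) (L≤capacity L)
      t≤ = ≤-trans (m≤m+n t (2 + n)) (L≤capacity L)
      -- `1+[2 Bin.zero ]` is the numeral 1, whose one digit explains the bound 1; its encoding is
      -- `nil ∙ nil`, the value of `true′`.
      r , r≡ , unrolled = positions-unroll L H n≤ t≤ n 0 1+[2 Bin.zero ] 1 n≤ ≤-refl (bits-fit n t) refl
  in trans
    (cong tail (run-fold (hd arg) (cons nil true′) positionF L (encodeHistory H) {unary n} refl
      (subst (_≤ capacity L) (sym (size-unary n)) n≤)))
    -- Numerals in bijective base 2 are unique, so knowing the value of `r` determines its encoding.
    (trans unrolled (trans (cong encodeBin (sym (fromℕ-toℕ r))) (cong binary r≡)))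

-- Counting and deciding feasibility.

countable-in-polynomial-time :
  ComputableInPolynomialTime (λ H k → HasCardinality (consistentSecrets H) k)
countable-in-polynomial-time =
  let p , c , d , runs = run-in-polynomial-time countF
  in p , c , d , λ {n} {t} H → count H , consistentSecrets-cardinality H ,
    subst (λ e → p on encodeHistory H yields e within (c * suc (n + t) ^ d)) (run-count H) (runs H)

positive : ℕ → Bool
positive zero    = false
positive (suc _) = true

-- In bijective base 2 the number 0 alone is encoded by `nil`, so one test decides positivity.
branch-binary : ∀ k → branch (binary k) (encodeBool true) (encodeBool false) ≡ encodeBool (positive k)
branch-binary k = trans (nonzero (Bin.fromℕ k)) (cong (encodeBool ∘ positive) (toℕ-fromℕ k))
  where
  nonzero : ∀ b → branch (encodeBin b) (encodeBool true) (encodeBool false) ≡ encodeBool (positive (Bin.toℕ b))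
  nonzero Bin.zero = refl
  nonzero 1+[2 b ] = refl
  nonzero 2[1+ b ] = refl

feasible-reflects : (H : History n t) → Reflects (Feasible H) (positive (count H))
feasible-reflects H with count H | consistentSecrets-cardinality H
... | zero  | inverse = ofⁿ λ secret → Fin.¬Fin0 (Inverse.from inverse secret)
... | suc _ | inverse = ofʸ (Inverse.to inverse zero)

feasibleF : Fun
feasibleF = countF ⟫ cond arg true′ nil

run-feasible : (H : History n t) →
  run feasibleF (clockLength n t) (encodeHistory H) ≡ encodeBool (positive (count H))
run-feasible H = trans (cong (λ k → branch k (encodeBool true) (encodeBool false)) (run-count H))
  (branch-binary (count H))

decidable-in-polynomial-time : DecidableInPolynomialTime Feasible
decidable-in-polynomial-time =
  let p , c , d , runs = run-in-polynomial-time feasibleF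
  in p , c , d , λ {n} {t} H → positive (count H) , feasible-reflects H ,
    subst (λ e → p on encodeHistory H yields e within (c * suc (n + t) ^ d)) (run-feasible H) (runs H)

theorem2p2 : DecidableInPolynomialTime Feasible ×
    ComputableInPolynomialTime (λ H k → HasCardinality (consistentSecrets H) k)
theorem2p2 = decidable-in-polynomial-time , countable-in-polynomial-time
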